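{- Let $\beta$ be a Salem number with minimal polynomial $P(x) = x^6 + ax^5 + bx^4 + cx^3 + bx^2 + ax + 1$, where $a,b,c\in\mathbb{Z}$. If $b \leq 2a - 3$, then $P(x)$ has no cyclotomic co-factor; that is, it is not the case that $\beta$ is a Parry number whose co-factor is a cyclotomic polynomial $\Phi_n(x)$ for some $n\ge1$.
   Context: A Salem number is a real algebraic integer $\beta>1$ whose other Galois conjugates all satisfy $|\alpha|\le 1$, with at least one satisfying $|\alpha|=1$. For real $\beta>1$, the greedy beta expansion $d_\beta(1)=(c_n)_{n\ge1}$ is defined by $r_0=1$, and for $n\ge 1$: $c_n=\lfloor \beta r_{n-1}\rfloor$, $r_n=\beta r_{n-1}-\lfloor \beta r_{n-1}\rfloor$. If it is eventually periodic, $\beta$ is called a Parry number, and the smallest $m\ge0$ and $p\ge1$ with $c_{n+m}=c_{n+m+p}$ for all $n\ge1$ are the preperiod length and the period length of the expansion. (By convention $p=0$ if $r_N=0$ for some $N$; this never happens for Salem numbers.) For a Salem number $\beta$ that is a Parry number with preperiod length $m$ and period length $p\geq 1$, put $P_k(x)=x^k-c_1x^{k-1}-\dots-c_k$. The companion polynomial is $R(x)=P_{m+p}(x)-P_m(x)$; it has $\beta$ as a root, so $R(x)=P(x)Q(x)$ with $P$ the minimal polynomial of $\beta$ and $Q\in\mathbb{Z}[x]$; $Q$ is the co-factor of $\beta$ (also called the co-factor of $P$). $\Phi_n$ denotes the $n$th cyclotomic polynomial. -}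

module Defs where

open import Algebra.Bundles.Raw using (RawRing)
open import Data.Integer as ℤ using (ℤ)
open import Data.List using (List; []; _∷_; _++_; map; foldr; filter; upTo; replicate)
open import Data.Nat as ℕ using (ℕ; zero; suc; _⊔_)
import Data.Nat.Properties as ℕ
open import Data.Nat.Divisibility using (_∣?_)
open import Data.Product using (Σ; ∃; ∃-syntax; _×_; _,_; proj₁; proj₂)
open import Data.Rational as ℚ using (ℚ; 0ℚ; 1ℚ; ½; ∣_∣)
import Data.Rational.Properties as ℚ
open import Data.Rational.Solver using (module +-*-Solver)
open import Level using (0ℓ)
open import Relation.Binary.PropositionalEquality
open import Relation.Nullary using (¬_)

-- A real number is a Cauchy sequence of rationals, taken up to _≈_ below.
IsCauchy : (ℕ → ℚ) → Set
IsCauchy x = ∀ ε → 0ℚ ℚ.< ε →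
  ∃[ N ] ∀ m n → N ℕ.≤ m → N ℕ.≤ n → ∣ x m ℚ.- x n ∣ ℚ.< ε

record ℝ : Set where
  constructor mkℝ
  field
    seq    : ℕ → ℚ
    cauchy : IsCauchy seq

open ℝ public

half-pos : ∀ {ε} → 0ℚ ℚ.< ε → 0ℚ ℚ.< ½ ℚ.* ε
half-pos {ε} 0<ε = subst (ℚ._< ½ ℚ.* ε) (ℚ.*-zeroʳ ½) (ℚ.*-monoʳ-<-pos ½ 0<ε)

half+half : ∀ ε → ½ ℚ.* ε ℚ.+ ½ ℚ.* ε ≡ ε
half+half ε = trans (sym (ℚ.*-distribʳ-+ ε ½ ½)) (ℚ.*-identityˡ ε)

const-cauchy : ∀ q → IsCauchy (λ _ → q)
const-cauchy q ε 0<ε =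
  0 , λ _ _ _ _ → subst (ℚ._< ε) (cong ∣_∣ (sym (ℚ.+-inverseʳ q))) 0<ε

+-cauchy : ∀ {x y} → IsCauchy x → IsCauchy y → IsCauchy (λ n → x n ℚ.+ y n)
+-cauchy {x} {y} cx cy ε 0<ε =
  let (M , hx) = cx (½ ℚ.* ε) (half-pos 0<ε)
      (N , hy) = cy (½ ℚ.* ε) (half-pos 0<ε)
  in M ⊔ N , λ m n p q → begin-strict
    ∣ (x m ℚ.+ y m) ℚ.- (x n ℚ.+ y n) ∣
      ≡⟨ cong ∣_∣ (regroup (x m) (y m) (x n) (y n)) ⟩
    ∣ (x m ℚ.- x n) ℚ.+ (y m ℚ.- y n) ∣
      ≤⟨ ℚ.∣p+q∣≤∣p∣+∣q∣ (x m ℚ.- x n) (y m ℚ.- y n) ⟩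
    ∣ x m ℚ.- x n ∣ ℚ.+ ∣ y m ℚ.- y n ∣
      <⟨ ℚ.+-mono-<
           (hx m n (ℕ.m⊔n≤o⇒m≤o M N p) (ℕ.m⊔n≤o⇒m≤o M N q))
           (hy m n (ℕ.m⊔n≤o⇒n≤o M N p) (ℕ.m⊔n≤o⇒n≤o M N q)) ⟩
    ½ ℚ.* ε ℚ.+ ½ ℚ.* ε
      ≡⟨ half+half ε ⟩
    ε ∎
  where
  open ℚ.≤-Reasoning
  regroup : ∀ a b c d → (a ℚ.+ b) ℚ.- (c ℚ.+ d) ≡ (a ℚ.- c) ℚ.+ (b ℚ.- d)
  regroup = solve 4 (λ a b c d →
    (a :+ b) :- (c :+ d) := (a :- c) :+ (b :- d)) refl
    where open +-*-Solver

neg-cauchy : ∀ {x} → IsCauchy x → IsCauchy (λ n → ℚ.- x n)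
neg-cauchy {x} cx ε 0<ε =
  let (N , h) = cx ε 0<ε
  in N , λ m n p q →
    subst (ℚ._< ε)
      (trans (sym (ℚ.∣-p∣≡∣p∣ (x m ℚ.- x n)))
             (cong ∣_∣ (ℚ.neg-distrib-+ (x m) (ℚ.- x n))))
      (h m n p q)

bound : ∀ {x} → IsCauchy x →
  ∃[ B ] ℚ.Positive B × ∃[ N ] ∀ n → N ℕ.≤ n → ∣ x n ∣ ℚ.≤ B
bound {x} cx =
  let (N , h) = cx 1ℚ (ℚ.positive⁻¹ 1ℚ)
  in 1ℚ ℚ.+ ∣ x N ∣
   , ℚ.positive (ℚ.+-mono-<-≤ (ℚ.positive⁻¹ 1ℚ) (ℚ.0≤∣p∣ (x N)))
   , N
   , λ n p → begin
       ∣ x n ∣                          ≡⟨ cong ∣_∣ (split (x n) (x N)) ⟩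
       ∣ (x n ℚ.- x N) ℚ.+ x N ∣        ≤⟨ ℚ.∣p+q∣≤∣p∣+∣q∣ (x n ℚ.- x N) (x N) ⟩
       ∣ x n ℚ.- x N ∣ ℚ.+ ∣ x N ∣      ≤⟨ ℚ.+-monoˡ-≤ ∣ x N ∣ (ℚ.<⇒≤ (h n N p ℕ.≤-refl)) ⟩
       1ℚ ℚ.+ ∣ x N ∣                   ∎
  where
  open ℚ.≤-Reasoning
  split : ∀ a b → a ≡ (a ℚ.- b) ℚ.+ b
  split = solve 2 (λ a b → a := (a :- b) :+ b) refl
    where open +-*-Solver

scale : ∀ B → ℚ.Positive B → ∀ ε → 0ℚ ℚ.< ε →
  ∃[ δ ] 0ℚ ℚ.< δ × B ℚ.* δ ≡ ε
scale B B>0 ε 0<ε =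
    B⁻¹ ℚ.* ε
  , subst (ℚ._< B⁻¹ ℚ.* ε) (ℚ.*-zeroʳ B⁻¹) (ℚ.*-monoʳ-<-pos B⁻¹ 0<ε)
  , trans (sym (ℚ.*-assoc B B⁻¹ ε))
      (trans (cong (ℚ._* ε) (ℚ.*-inverseʳ B)) (ℚ.*-identityˡ ε))
  where
  instance
    B-pos : ℚ.Positive B
    B-pos = B>0
    B≢0 : ℚ.NonZero B
    B≢0 = ℚ.pos⇒nonZero B
  B⁻¹ : ℚ
  B⁻¹ = ℚ.1/ B
  instance
    B⁻¹-pos : ℚ.Positive B⁻¹
    B⁻¹-pos = ℚ.1/pos⇒pos B

*-cauchy : ∀ {x y} → IsCauchy x → IsCauchy y → IsCauchy (λ n → x n ℚ.* y n)
*-cauchy {x} {y} cx cy ε 0<ε =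
  let (A , A>0 , K , hA) = bound cx
      (B , B>0 , L , hB) = bound cy
      (δ₁ , 0<δ₁ , e₁) = scale A A>0 (½ ℚ.* ε) (half-pos 0<ε)
      (δ₂ , 0<δ₂ , e₂) = scale B B>0 (½ ℚ.* ε) (half-pos 0<ε)
      (M , hy) = cy δ₁ 0<δ₁
      (N , hx) = cx δ₂ 0<δ₂
  in (K ⊔ L) ⊔ (M ⊔ N) , λ m n p q →
    let p₁ = ℕ.m⊔n≤o⇒m≤o (K ⊔ L) (M ⊔ N) p ; p₂ = ℕ.m⊔n≤o⇒n≤o (K ⊔ L) (M ⊔ N) p
        q₁ = ℕ.m⊔n≤o⇒m≤o (K ⊔ L) (M ⊔ N) q ; q₂ = ℕ.m⊔n≤o⇒n≤o (K ⊔ L) (M ⊔ N) q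
    in begin-strict
    ∣ x m ℚ.* y m ℚ.- x n ℚ.* y n ∣
      ≡⟨ cong ∣_∣ (regroup (x m) (y m) (x n) (y n)) ⟩
    ∣ x m ℚ.* (y m ℚ.- y n) ℚ.+ y n ℚ.* (x m ℚ.- x n) ∣
      ≤⟨ ℚ.∣p+q∣≤∣p∣+∣q∣ (x m ℚ.* (y m ℚ.- y n)) (y n ℚ.* (x m ℚ.- x n)) ⟩
    ∣ x m ℚ.* (y m ℚ.- y n) ∣ ℚ.+ ∣ y n ℚ.* (x m ℚ.- x n) ∣
      <⟨ ℚ.+-mono-<
           (product-bound A A>0 (x m) (y m ℚ.- y n)
             (hA m (ℕ.m⊔n≤o⇒m≤o K L p₁))
             (hy m n (ℕ.m⊔n≤o⇒m≤o M N p₂) (ℕ.m⊔n≤o⇒m≤o M N q₂)))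
           (product-bound B B>0 (y n) (x m ℚ.- x n)
             (hB n (ℕ.m⊔n≤o⇒n≤o K L q₁))
             (hx m n (ℕ.m⊔n≤o⇒n≤o M N p₂) (ℕ.m⊔n≤o⇒n≤o M N q₂))) ⟩
    A ℚ.* δ₁ ℚ.+ B ℚ.* δ₂
      ≡⟨ cong₂ ℚ._+_ e₁ e₂ ⟩
    ½ ℚ.* ε ℚ.+ ½ ℚ.* ε
      ≡⟨ half+half ε ⟩
    ε ∎
  where
  open ℚ.≤-Reasoning
  regroup : ∀ a b c d →
    a ℚ.* b ℚ.- c ℚ.* d ≡ a ℚ.* (b ℚ.- d) ℚ.+ d ℚ.* (a ℚ.- c)
  regroup = solve 4 (λ a b c d →
    a :* b :- c :* d := a :* (b :- d) :+ d :* (a :- c)) refl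
    where open +-*-Solver
  product-bound : ∀ C → ℚ.Positive C → ∀ u v {δ} →
    ∣ u ∣ ℚ.≤ C → ∣ v ∣ ℚ.< δ → ∣ u ℚ.* v ∣ ℚ.< C ℚ.* δ
  product-bound C C>0 u v {δ} u≤C v<δ = begin-strict
    ∣ u ℚ.* v ∣       ≡⟨ ℚ.∣p*q∣≡∣p∣*∣q∣ u v ⟩
    ∣ u ∣ ℚ.* ∣ v ∣   ≤⟨ ℚ.*-monoʳ-≤-nonNeg ∣ v ∣ {{ℚ.nonNegative (ℚ.0≤∣p∣ v)}} u≤C ⟩
    C ℚ.* ∣ v ∣       <⟨ ℚ.*-monoʳ-<-pos C {{C>0}} v<δ ⟩
    C ℚ.* δ           ∎

infix 4 _≈_ _≤_ _<_

_≈_ : ℝ → ℝ → Set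
x ≈ y = ∀ ε → 0ℚ ℚ.< ε → ∃[ N ] ∀ n → N ℕ.≤ n → ∣ seq x n ℚ.- seq y n ∣ ℚ.< ε

_≤_ : ℝ → ℝ → Set
x ≤ y = ∀ ε → 0ℚ ℚ.< ε → ∃[ N ] ∀ n → N ℕ.≤ n → seq x n ℚ.< seq y n ℚ.+ ε

_<_ : ℝ → ℝ → Set
x < y = ∃[ ε ] 0ℚ ℚ.< ε × ∃[ N ] ∀ n → N ℕ.≤ n → seq x n ℚ.+ ε ℚ.< seq y n

fromℚ : ℚ → ℝ
fromℚ q = mkℝ (λ _ → q) (const-cauchy q)

ℤ→ℚ : ℤ → ℚ
ℤ→ℚ z = z ℚ./ 1

fromℤ : ℤ → ℝ
fromℤ z = fromℚ (ℤ→ℚ z)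

0ℝ 1ℝ : ℝ
0ℝ = fromℚ 0ℚ
1ℝ = fromℚ 1ℚ

infixl 6 _+_ _-_
infixl 7 _*_
infix  8 -_

_+_ : ℝ → ℝ → ℝ
x + y = mkℝ (λ n → seq x n ℚ.+ seq y n) (+-cauchy {seq x} {seq y} (cauchy x) (cauchy y))

_*_ : ℝ → ℝ → ℝ
x * y = mkℝ (λ n → seq x n ℚ.* seq y n) (*-cauchy {seq x} {seq y} (cauchy x) (cauchy y))

-_ : ℝ → ℝ
- x = mkℝ (λ n → ℚ.- seq x n) (neg-cauchy {seq x} (cauchy x))

_-_ : ℝ → ℝ → ℝ
x - y = x + (- y)

ℝ-rawRing : RawRing 0ℓ 0ℓ
ℝ-rawRing = record
  { _≈_ = _≈_ ; _+_ = _+_ ; _*_ = _*_ ; -_ = -_ ; 0# = 0ℝ ; 1# = 1ℝ }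

record ℂ : Set where
  constructor _+i_
  field
    re im : ℝ

open ℂ public

infix 4 _≈ᶜ_

_≈ᶜ_ : ℂ → ℂ → Set
z ≈ᶜ w = re z ≈ re w × im z ≈ im w

fromℝ : ℝ → ℂ
fromℝ x = x +i 0ℝ

ℂ-rawRing : RawRing 0ℓ 0ℓ
ℂ-rawRing = record
  { _≈_ = _≈ᶜ_
  ; _+_ = λ z w → (re z + re w) +i (im z + im w)
  ; _*_ = λ z w → (re z * re w - im z * im w) +i (re z * im w + im z * re w)
  ; -_  = λ z → (- re z) +i (- im z)
  ; 0#  = fromℝ 0ℝ
  ; 1#  = fromℝ 1ℝ
  }

-- The squared modulus |z|².  Comparisons of |z| with 1 are made on squares.
normSq : ℂ → ℝ
normSq z = re z * re z + im z * im z

-- Univariate polynomials as coefficient lists, constant term first;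
-- trailing zeros are allowed, so equality is the coefficientwise _≋_.

module Polynomial (R : RawRing 0ℓ 0ℓ) where
  open RawRing R
    renaming (Carrier to A; _≈_ to _≈ᴿ_; _+_ to _+ᴿ_; _*_ to _*ᴿ_; -_ to -ᴿ_)

  Poly : Set
  Poly = List A

  coeff : Poly → ℕ → A
  coeff []      _       = 0#
  coeff (a ∷ f) zero    = a
  coeff (a ∷ f) (suc i) = coeff f i

  infix  4 _≋_
  infixl 6 _⊞_ _⊟_
  infixl 7 _⊠_

  _≋_ : Poly → Poly → Set
  f ≋ g = ∀ i → coeff f i ≈ᴿ coeff g i

  _⊞_ : Poly → Poly → Poly
  []      ⊞ g       = g
  (a ∷ f) ⊞ []      = a ∷ f
  (a ∷ f) ⊞ (b ∷ g) = (a +ᴿ b) ∷ (f ⊞ g)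

  _⊟_ : Poly → Poly → Poly
  f ⊟ g = f ⊞ map -ᴿ_ g

  _⊠_ : Poly → Poly → Poly
  []      ⊠ g = []
  (a ∷ f) ⊠ g = map (a *ᴿ_) g ⊞ (0# ∷ (f ⊠ g))

  one : Poly
  one = 1# ∷ []

  X^_ : ℕ → Poly
  X^ n = replicate n 0# ++ one

  ∏ : List Poly → Poly
  ∏ = foldr _⊠_ one

  Monic : ℕ → Poly → Set
  Monic d f = coeff f d ≈ᴿ 1# × (∀ i → d ℕ.< i → coeff f i ≈ᴿ 0#)

  eval : (S : RawRing 0ℓ 0ℓ) → (A → RawRing.Carrier S) →
         Poly → RawRing.Carrier S → RawRing.Carrier S
  eval S ι []      x = RawRing.0# S
  eval S ι (a ∷ f) x = ι a S.+ x S.* eval S ι f x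
    where module S = RawRing S

module ℤ[x] = Polynomial ℤ.+-*-rawRing
module ℚ[x] = Polynomial ℚ.+-*-rawRing

evalℝ : ℚ[x].Poly → ℝ → ℝ
evalℝ = ℚ[x].eval ℝ-rawRing fromℚ

evalℂ : ℚ[x].Poly → ℂ → ℂ
evalℂ = ℚ[x].eval ℂ-rawRing (λ q → fromℝ (fromℚ q))

ℤ[x]→ℚ[x] : ℤ[x].Poly → ℚ[x].Poly
ℤ[x]→ℚ[x] = map ℤ→ℚ

IsAlgebraicInteger : ℝ → Set
IsAlgebraicInteger β =
  ∃[ d ] ∃[ f ] ℤ[x].Monic d f × evalℝ (ℤ[x]→ℚ[x] f) β ≈ 0ℝ

-- The monic rational polynomial of least degree vanishing at β.
record IsMinimalPolynomial (β : ℝ) (f : ℚ[x].Poly) : Set where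
  field
    degree : ℕ
    monic  : ℚ[x].Monic degree f
    root   : evalℝ f β ≈ 0ℝ
    least  : ∀ e g → ℚ[x].Monic e g → evalℝ g β ≈ 0ℝ → degree ℕ.≤ e

IsConjugate : ℝ → ℂ → Set
IsConjugate β α = ∃[ f ] IsMinimalPolynomial β f × evalℂ f α ≈ᶜ fromℝ 0ℝ

record IsSalem (β : ℝ) : Set where
  field
    algebraicInteger : IsAlgebraicInteger β
    greaterThanOne   : 1ℝ < β
    othersInDisc     : ∀ α → IsConjugate β α → ¬ (α ≈ᶜ fromℝ β) → normSq α ≤ 1ℝ
    someOnCircle     : ∃[ α ] IsConjugate β α × ¬ (α ≈ᶜ fromℝ β) × normSq α ≈ 1ℝ

IsFloor : ℝ → ℤ → Set
IsFloor x z = fromℤ z ≤ x × x < fromℤ z + 1ℝ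

-- Digit sequences c are indexed from 1: the value c 0 is never used.
remainder : ℝ → (ℕ → ℤ) → ℕ → ℝ
remainder β c zero    = 1ℝ
remainder β c (suc n) = β * remainder β c n - fromℤ (c (suc n))

-- The floor is a relation, as it is not a computable function on ℝ; the
-- digits c 1, c 2, … are uniquely determined by β.
IsGreedyExpansion : ℝ → (ℕ → ℤ) → Set
IsGreedyExpansion β c = ∀ n → IsFloor (β * remainder β c n) (c (suc n))

IsPeriodicFrom : (ℕ → ℤ) → ℕ → ℕ → Set
IsPeriodicFrom c m p = ∀ n → 1 ℕ.≤ n → c (n ℕ.+ m) ≡ c (n ℕ.+ m ℕ.+ p)

record HasPreperiodAndPeriod (c : ℕ → ℤ) (m p : ℕ) : Set where
  field
    period≥1 : 1 ℕ.≤ p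
    periodic : IsPeriodicFrom c m p
    smallest : ∀ m′ p′ → 1 ℕ.≤ p′ → IsPeriodicFrom c m′ p′ → m ℕ.≤ m′ × p ℕ.≤ p′

-- x^k - c₁ x^(k-1) - … - c_k, using P_{k+1} = x P_k - c_{k+1}.
expansionPoly : (ℕ → ℤ) → ℕ → ℤ[x].Poly
expansionPoly c zero    = ℤ[x].one
expansionPoly c (suc k) = ℤ.- c (suc k) ∷ expansionPoly c k

companion : (ℕ → ℤ) → ℕ → ℕ → ℤ[x].Poly
companion c m p = expansionPoly c (m ℕ.+ p) ℤ[x].⊟ expansionPoly c m

-- β is a Parry number with minimal polynomial P and co-factor Q.  A finite
-- expansion (remainder 0 at some N) would by convention have period 0, not 1;
-- it is not excluded here since it never occurs for a Salem number.
record IsCofactor (β : ℝ) (P Q : ℤ[x].Poly) : Set where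
  field
    minimal         : IsMinimalPolynomial β (ℤ[x]→ℚ[x] P)
    digits          : ℕ → ℤ
    preperiod       : ℕ
    period          : ℕ
    greedy          : IsGreedyExpansion β digits
    periodic        : HasPreperiodAndPeriod digits preperiod period
    factorization   : companion digits preperiod period ℤ[x].≋ P ℤ[x].⊠ Q

divisors : ℕ → List ℕ
divisors n = filter (_∣? n) (map suc (upTo n))

-- Q = Φ_n, where the sequence Φ₁, Φ₂, … in ℤ[x] is defined recursively by
-- ∏_{d ∣ k} Φ_d = x^k - 1 for k ≥ 1.  This determines every Φ_k up to _≋_,
-- since the proper divisors contribute a monic factor.
IsCyclotomic : ℕ → ℤ[x].Poly → Set
IsCyclotomic n Q =
  Σ (ℕ → ℤ[x].Poly) λ Φ →
    (∀ k → 1 ℕ.≤ k →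
       ℤ[x].∏ (map Φ (divisors k)) ℤ[x].≋ (ℤ[x].X^ k) ℤ[x].⊟ ℤ[x].one)
    × Q ℤ[x].≋ Φ n

{-# OPTIONS --safe #-}
module Submission where

-- Let γᵢ be the numbers α + 1/α for the conjugates α of β other than β, 1/β.
-- The hypothesis b ≤ 2a - 3 forces γ₁ + γ₂ < -2, and hence ⌊β⌋ ≥ 2 - a, while
-- comparing the second coefficients of the companion polynomial and of P Φₙ
-- gives ⌊β⌋ = c₁ ≤ μ(n) - a ≤ 1 - a.
--
-- The bound ⌊β⌋ ≥ 2 - a is obtained without exhibiting the conjugates.  If
-- β < 2 - a, an explicit identity shows P(-1) < 0, so P has a root α < -1, which
-- bisection on the rationals constructs; but then |α| > 1 contradicts β Salem.

open import Defs using (ℝ; IsSalem; IsMinimalPolynomial; IsCofactor; IsCyclotomic; ℤ[x]→ℚ[x]; module ℤ[x])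
open import Data.Integer using (ℤ; +_; _≤_; _-_; _*_)
open import Data.List using (List; []; _∷_)
open import Data.Nat as ℕ using (ℕ)
open import Data.Product using (_×_; ∃-syntax)
open import Relation.Nullary using (¬_)

import Algebra.Properties.AbelianGroup as AbelianGroup
open import Data.Empty using (⊥; ⊥-elim)
open import Data.Integer as ℤ using (0ℤ; 1ℤ; -1ℤ)
import Data.Integer.Properties as ℤ
open import Data.Integer.Tactic.RingSolver using (solve-∀)
open import Data.List using (_++_; map; filter; upTo; foldr; length)
open import Data.List.Membership.Propositional using (_∈_)
open import Data.List.Membership.Propositional.Properties using (∈-map⁺; ∈-map⁻; ∈-filter⁺; ∈-filter⁻; ∈-upTo⁺; ∈-++⁺ˡ; ∈-++⁺ʳ; ∈-++⁻)
open import Data.List.Membership.Propositional.Properties.WithK using (unique∧set⇒bag)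
open import Data.List.Relation.Binary.BagAndSetEquality using (∼bag⇒↭)
import Data.List.Relation.Binary.Permutation.Propositional as ↭
open ↭ using (_↭_)
open import Data.List.Relation.Unary.All as All using ([]; _∷_)
open import Data.List.Relation.Unary.AllPairs using ([]; _∷_)
open import Data.List.Relation.Unary.Any using (here; there)
open import Data.List.Relation.Unary.Unique.Propositional using (Unique)
import Data.List.Relation.Unary.Unique.Propositional.Properties as Unique
open import Data.Nat using (zero; suc; s≤s; z≤n; _⊔_; NonZero)
open import Data.Nat.Coprimality using (Coprime; coprime-divisor)
open import Data.Nat.Divisibility using (_∣_; _∣?_; ∣⇒≤; ∣-refl; ∣-trans; divides; m∣m*n; n∣m*n; *-monoʳ-∣; *-monoˡ-∣; *-cancelˡ-∣; 0∣⇒≡0)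
open import Data.Nat.Induction using (<-rec)
open import Data.Nat.ListAction using (product)
open import Data.Nat.Primality using (Prime; prime⇒irreducible; prime⇒nonZero; prime⇒nonTrivial)
open import Data.Nat.Primality.Factorisation using (factorise)
import Data.Nat.Properties as ℕ
open import Data.Product using (_,_; proj₁; proj₂)
open import Data.Rational as ℚ using (ℚ; 0ℚ; 1ℚ; ½; ∣_∣)
import Data.Rational.Literals as ℚ
import Data.Rational.Properties as ℚ
open import Data.Rational.Solver using (module +-*-Solver)
open import Data.Sum using (_⊎_; inj₁; inj₂; [_,_]′)
open import Defs using (mkℝ; seq; IsCauchy; scale; _≈_; _<_; 0ℝ; 1ℝ; ℂ; _+i_; re; im; _≈ᶜ_; fromℝ; evalℝ; evalℂ; ℤ→ℚ; module ℚ[x]; divisors; expansionPoly; companion; IsGreedyExpansion; HasPreperiodAndPeriod)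
open import Function using (_∘_; _⇔_; mk⇔)
open import Relation.Binary.Definitions using (tri<; tri≈; tri>)
open import Relation.Binary.PropositionalEquality
open import Relation.Nullary using (yes; no; ¬?)

-- The γᵢ stay hidden behind P(-1). With y = x + 1/x, P(x) = x³ G(y) for the cubic G(y) = y³ + a y²
-- + (b - 3) y + c - 2a with roots β + 1/β, γ₁, γ₂. So P(-1) = -G(-2) is the product of 2 + y over
-- these roots, and the γᵢ can lie in [-2, 2] only if P(-1) ≥ 0. Dividing G(y) - G(-2) by y + 2 = (x
-- + 1)²/x yields the explicit identity. Unlike the order of the reals β and 2 - a, the sign of the
-- rational P(-1) is decidable, so the argument is a clash of signs: the Salem property excludes
-- P(-1) < 0, the digit bound excludes P(-1) ≥ 0.
--
-- On the cyclotomic side only μ(n) ≤ 1 is at stake. The Φ_d are known only through their products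
-- x^k - 1, so neither degrees nor monicity are given. Normalising each factor by its leading sign
-- turns the products into divisor sums of second coefficients, and these sums determine -μ.

open ℤ[x]
open AbelianGroup ℤ.+-0-abelianGroup using (inverseʳ-unique)
open AbelianGroup ℚ.+-0-abelianGroup using () renaming (⁻¹-involutive to neg-involutive)
open +-*-Solver using (solve; _:=_; _:+_; _:*_; _:-_; :-_; con)

-- Second coefficients of polynomials

-- The coefficient of x^(d-1) is read off 0 ∷ f, so that it is 0 when d = 0.
record Top (d : ℕ) (a t : ℤ) (f : Poly) : Set where
  constructor mkTop
  field
    leading : coeff f d ≡ a
    next    : coeff (0ℤ ∷ f) d ≡ t
    above   : ∀ i → d ℕ.< i → coeff f i ≡ 0ℤ

coeff-⊞ : ∀ f g i → coeff (f ⊞ g) i ≡ coeff f i ℤ.+ coeff g i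
coeff-⊞ []      g       i       = sym (ℤ.+-identityˡ _)
coeff-⊞ (x ∷ f) []      i       = sym (ℤ.+-identityʳ _)
coeff-⊞ (x ∷ f) (y ∷ g) zero    = refl
coeff-⊞ (x ∷ f) (y ∷ g) (suc i) = coeff-⊞ f g i

coeff-map : ∀ {φ : ℤ → ℤ} → φ 0ℤ ≡ 0ℤ → ∀ f i → coeff (map φ f) i ≡ φ (coeff f i)
coeff-map φ0 []      i       = sym φ0
coeff-map φ0 (x ∷ f) zero    = refl
coeff-map φ0 (x ∷ f) (suc i) = coeff-map φ0 f i

coeff-⊟ : ∀ f g i → coeff (f ⊟ g) i ≡ coeff f i - coeff g i
coeff-⊟ f g i = trans (coeff-⊞ f _ i) (cong (ℤ._+_ (coeff f i)) (coeff-map refl g i))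

coeff-beyond : ∀ f i → length f ℕ.≤ i → coeff f i ≡ 0ℤ
coeff-beyond []      i       _         = refl
coeff-beyond (x ∷ f) (suc i) (s≤s f≤i) = coeff-beyond f i f≤i

coeff-∷-⊠ : ∀ x f g i →
  coeff ((x ∷ f) ⊠ g) i ≡ x * coeff g i ℤ.+ coeff (0ℤ ∷ f ⊠ g) i
coeff-∷-⊠ x f g i =
  trans (coeff-⊞ (map (x *_) g) _ i)
        (cong (ℤ._+ coeff (0ℤ ∷ f ⊠ g) i) (coeff-map (ℤ.*-zeroʳ x) g i))

coeff-0∷-⊠ : ∀ x f g i →
  coeff (0ℤ ∷ (x ∷ f) ⊠ g) i ≡ x * coeff (0ℤ ∷ g) i ℤ.+ coeff (0ℤ ∷ 0ℤ ∷ f ⊠ g) i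
coeff-0∷-⊠ x f g zero    = sym (trans (ℤ.+-identityʳ _) (ℤ.*-zeroʳ x))
coeff-0∷-⊠ x f g (suc i) = coeff-∷-⊠ x f g i

0∷-≋[] : ∀ {f} → f ≋ [] → 0ℤ ∷ f ≋ []
0∷-≋[] f≋0 zero    = refl
0∷-≋[] f≋0 (suc i) = f≋0 i

⊠-zeroˡ : ∀ f g → f ≋ [] → f ⊠ g ≋ []
⊠-zeroˡ []      g f≋0 i = refl
⊠-zeroˡ (x ∷ f) g f≋0 i =
  trans (coeff-∷-⊠ x f g i)
        (cong₂ (λ y z → y * coeff g i ℤ.+ z) (f≋0 0)
               (0∷-≋[] (⊠-zeroˡ f g (f≋0 ∘ suc)) i))

⊠-zeroʳ : ∀ f g → g ≋ [] → f ⊠ g ≋ []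
⊠-zeroʳ []      g g≋0 i = refl
⊠-zeroʳ (x ∷ f) g g≋0 i =
  trans (coeff-∷-⊠ x f g i)
        (cong₂ ℤ._+_ (trans (cong (x *_) (g≋0 i)) (ℤ.*-zeroʳ x))
                     (0∷-≋[] (⊠-zeroʳ f g g≋0) i))

Top-resp-≋ : ∀ {d a t f g} → f ≋ g → Top d a t f → Top d a t g
Top-resp-≋ {d} {f = f} {g} f≋g (mkTop l n z) =
  mkTop (trans (sym (f≋g d)) l) (trans (sym (shifted d)) n)
        (λ i d<i → trans (sym (f≋g i)) (z i d<i))
  where
  shifted : 0ℤ ∷ f ≋ 0ℤ ∷ g
  shifted zero    = refl
  shifted (suc i) = f≋g i

Top-unique : ∀ {d e a b s t f} → a ≢ 0ℤ → b ≢ 0ℤ →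
  Top d a s f → Top e b t f → a ≡ b × s ≡ t
Top-unique {d} {e} a≢0 b≢0 (mkTop l n z) (mkTop l′ n′ z′) with ℕ.<-cmp d e
... | tri< d<e _ _  = ⊥-elim (b≢0 (trans (sym l′) (z e d<e)))
... | tri> _ _ e<d  = ⊥-elim (a≢0 (trans (sym l) (z′ d e<d)))
... | tri≈ _ refl _ = trans (sym l) l′ , trans (sym n) n′

≋[]⊎Top : ∀ f → f ≋ [] ⊎ (∃[ d ] ∃[ a ] ∃[ t ] (a ≢ 0ℤ × Top d a t f))
≋[]⊎Top []      = inj₁ (λ _ → refl)
≋[]⊎Top (x ∷ f) with ≋[]⊎Top f
... | inj₂ (d , a , t , a≢0 , top) =
  inj₂ (suc d , a , _ , a≢0 , mkTop (Top.leading top) refl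
    λ { (suc i) (s≤s d<i) → Top.above top i d<i })
... | inj₁ f≋0 with x ℤ.≟ 0ℤ
...   | yes x≡0 = inj₁ λ { zero → x≡0 ; (suc i) → f≋0 i }
...   | no  x≢0 =
  inj₂ (0 , x , 0ℤ , x≢0 , mkTop refl refl λ { (suc i) _ → f≋0 i })

-- The degrees are formal: a and b may be 0. This lets the induction pass to the tail of f, with the
-- same leading coefficient in degree d - 1.
Top-⊠ : ∀ {d e a b s t} f g → Top d a t f → Top e b s g →
  Top (d ℕ.+ e) (a * b) (a * s ℤ.+ t * b) (f ⊠ g)
Top-⊠ {d} {e} {b = b} [] g (mkTop refl n _) _ =
  mkTop refl (trans (0∷0 (d ℕ.+ e)) (sym (cong (λ t → 0ℤ ℤ.+ t * b) (trans (sym n) (0∷0 d)))))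
        (λ _ _ → refl)
  where
  0∷0 : 0ℤ ∷ [] ≋ []
  0∷0 = 0∷-≋[] (λ _ → refl)
Top-⊠ {zero} {e} {a} {b} {s} (x ∷ f) g (mkTop refl refl z) (mkTop refl refl z′) =
  mkTop
    (trans (coeff-∷-⊠ x f g e)
      (trans (cong (ℤ._+_ (x * _)) (0∷-≋[] fg≋0 e)) (ℤ.+-identityʳ _)))
    (trans (coeff-0∷-⊠ x f g e) (cong (ℤ._+_ (x * _)) (0∷-≋[] (0∷-≋[] fg≋0) e)))
    (λ i e<i → trans (coeff-∷-⊠ x f g i)
      (cong₂ ℤ._+_ (trans (cong (x *_) (z′ i e<i)) (ℤ.*-zeroʳ x)) (0∷-≋[] fg≋0 i)))
  where
  fg≋0 : f ⊠ g ≋ []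
  fg≋0 = ⊠-zeroˡ f g (λ i → z (suc i) (s≤s z≤n))
Top-⊠ {suc d} {e} {a} {b} {s} {t} (x ∷ f) g (mkTop l n z) Tg@(mkTop l′ n′ z′) =
  mkTop
    (trans (coeff-∷-⊠ x f g (suc (d ℕ.+ e)))
      (trans (cong₂ ℤ._+_ (x*0 (s≤s (ℕ.m≤n+m e d))) (Top.leading IH))
             (ℤ.+-identityˡ _)))
    (trans (coeff-∷-⊠ x f g (d ℕ.+ e))
      (trans (cong (ℤ._+_ (x * coeff g (d ℕ.+ e))) (Top.next IH))
             (second d l n refl)))
    (λ { (suc i) (s≤s d+e<i) → trans (coeff-∷-⊠ x f g (suc i))
      (cong₂ ℤ._+_ (x*0 (s≤s (ℕ.≤-trans (ℕ.m≤n+m e d) (ℕ.<⇒≤ d+e<i))))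
                   (Top.above IH i d+e<i)) })
  where
  IH : Top (d ℕ.+ e) (a * b) (a * s ℤ.+ coeff (0ℤ ∷ f) d * b) (f ⊠ g)
  IH = Top-⊠ f g (mkTop l refl (λ i d<i → z (suc i) (s≤s d<i))) Tg
  x*0 : ∀ {i} → e ℕ.< i → x * coeff g i ≡ 0ℤ
  x*0 e<i = trans (cong (x *_) (z′ _ e<i)) (ℤ.*-zeroʳ x)
  -- The constant term x reaches the second coefficient of the product only when x ∷ f is linear;
  -- there x is t itself and multiplies the leading b of g.
  second : ∀ d′ → coeff f d′ ≡ a → coeff (x ∷ f) d′ ≡ t → d′ ≡ d →
    x * coeff g (d′ ℕ.+ e) ℤ.+ (a * s ℤ.+ coeff (0ℤ ∷ f) d′ * b) ≡ a * s ℤ.+ t * b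
  second zero _ refl _ =
    trans (cong (λ y → x * y ℤ.+ (a * s ℤ.+ 0ℤ)) l′) (lemma x a s b)
    where
    lemma : ∀ x a s b → x * b ℤ.+ (a * s ℤ.+ 0ℤ) ≡ a * s ℤ.+ x * b
    lemma = solve-∀
  second (suc d′) _ refl _ =
    trans (cong (ℤ._+ _) (x*0 (s≤s (ℕ.m≤n+m e d′)))) (ℤ.+-identityˡ _)

-- The second coefficient of ±f for the sign that makes f monic, which unlike
-- the second coefficient itself is additive under multiplication.
IsUnitTop : Poly → ℤ → Set
IsUnitTop f s = ∃[ d ] ∃[ a ] ∃[ t ] (Top d a t f × a * a ≡ 1ℤ × t * a ≡ s)

IsUnitTop-resp-≋ : ∀ {f g s} → f ≋ g → IsUnitTop f s → IsUnitTop g s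
IsUnitTop-resp-≋ f≋g (d , a , t , top , u , e) = d , a , t , Top-resp-≋ f≋g top , u , e

unit≢0 : ∀ {a} → a * a ≡ 1ℤ → a ≢ 0ℤ
unit≢0 () refl

*-unit⇒unit : ∀ a b → (a * b) * (a * b) ≡ 1ℤ → a * a ≡ 1ℤ × b * b ≡ 1ℤ
*-unit⇒unit a b ab²≡1 = square a ∣a∣≡1 , square b ∣b∣≡1
  where
  ∣ab∣²≡1 : (ℤ.∣ a ∣ ℕ.* ℤ.∣ b ∣) ℕ.* (ℤ.∣ a ∣ ℕ.* ℤ.∣ b ∣) ≡ 1
  ∣ab∣²≡1 = trans (sym (cong₂ ℕ._*_ (ℤ.abs-* a b) (ℤ.abs-* a b)))
                  (trans (sym (ℤ.abs-* (a * b) (a * b))) (cong ℤ.∣_∣ ab²≡1))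
  ∣ab∣≡1 : ℤ.∣ a ∣ ℕ.* ℤ.∣ b ∣ ≡ 1
  ∣ab∣≡1 = ℕ.m*n≡1⇒m≡1 _ _ ∣ab∣²≡1
  ∣a∣≡1 : ℤ.∣ a ∣ ≡ 1
  ∣a∣≡1 = ℕ.m*n≡1⇒m≡1 _ _ ∣ab∣≡1
  ∣b∣≡1 : ℤ.∣ b ∣ ≡ 1
  ∣b∣≡1 = ℕ.m*n≡1⇒n≡1 ℤ.∣ a ∣ _ ∣ab∣≡1
  square : ∀ x → ℤ.∣ x ∣ ≡ 1 → x * x ≡ 1ℤ
  square (+ .1) refl = refl
  square ℤ.-[1+ .0 ] refl = refl

IsUnitTop-unique : ∀ {f s t} → IsUnitTop f s → IsUnitTop f t → s ≡ t
IsUnitTop-unique (_ , _ , _ , T , u , refl) (_ , _ , _ , T′ , u′ , refl)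
  with refl , refl ← Top-unique (unit≢0 u) (unit≢0 u′) T T′ = refl

unitTop≢0 : ∀ {f s} → IsUnitTop f s → ¬ (f ≋ [])
unitTop≢0 (d , a , t , T , u , _) f≋0 = unit≢0 u (trans (sym (Top.leading T)) (f≋0 d))

-- Information flows from the product to its factors, because ±1 splits in ℤ only into units. This
-- is how each Φ_d acquires a leading coefficient ±1.
IsUnitTop-⊠ : ∀ {r} f g → IsUnitTop (f ⊠ g) r →
  ∃[ s ] ∃[ t ] (IsUnitTop f s × IsUnitTop g t × r ≡ s ℤ.+ t)
IsUnitTop-⊠ f g Tfg@(_ , _ , _ , T , u , refl) with ≋[]⊎Top f | ≋[]⊎Top g
... | inj₁ f≋0 | _        = ⊥-elim (unitTop≢0 Tfg (⊠-zeroˡ f g f≋0))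
... | inj₂ _   | inj₁ g≋0 = ⊥-elim (unitTop≢0 Tfg (⊠-zeroʳ f g g≋0))
... | inj₂ (_ , a , t , a≢0 , Tf) | inj₂ (_ , b , s , b≢0 , Tg)
  with refl , refl ← Top-unique (unit≢0 u)
         (λ ab≡0 → [ a≢0 , b≢0 ]′ (ℤ.i*j≡0⇒i≡0∨j≡0 a ab≡0)) T (Top-⊠ f g Tf Tg)
  with a²≡1 , b²≡1 ← *-unit⇒unit a b u =
    t * a , s * b , (_ , a , t , Tf , a²≡1 , refl) , (_ , b , s , Tg , b²≡1 , refl)
  , (begin
    (a * s ℤ.+ t * b) * (a * b)           ≡⟨ lemma a b s t ⟩
    (t * a) * (b * b) ℤ.+ s * b * (a * a) ≡⟨ cong₂ ℤ._+_ (cong (t * a *_) b²≡1) (cong (s * b *_) a²≡1) ⟩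
    (t * a) * 1ℤ ℤ.+ s * b * 1ℤ           ≡⟨ cong₂ ℤ._+_ (ℤ.*-identityʳ (t * a)) (ℤ.*-identityʳ (s * b)) ⟩
    t * a ℤ.+ s * b                       ∎)
  where
  open ≡-Reasoning
  lemma : ∀ a b s t → (a * s ℤ.+ t * b) * (a * b) ≡ (t * a) * (b * b) ℤ.+ s * b * (a * a)
  lemma = solve-∀

∑ : (ℕ → ℤ) → List ℕ → ℤ
∑ f = foldr (λ d s → f d ℤ.+ s) 0ℤ

-- A function rather than a relation, so that its values can be summed over divisors; 0 for the zero
-- polynomial is a default.
unitTop : Poly → ℤ
unitTop f with ≋[]⊎Top f
... | inj₁ _               = 0ℤ
... | inj₂ (_ , a , t , _) = t * a

unitTop-correct : ∀ {f s} → IsUnitTop f s → unitTop f ≡ s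
unitTop-correct {f} Tf@(_ , _ , _ , T , u , refl) with ≋[]⊎Top f
... | inj₁ f≋0                   = ⊥-elim (unitTop≢0 Tf f≋0)
... | inj₂ (_ , _ , _ , a≢0 , T′) with refl , refl ← Top-unique (unit≢0 u) a≢0 T T′ = refl

IsUnitTop-one : IsUnitTop one 0ℤ
IsUnitTop-one = 0 , 1ℤ , 0ℤ , mkTop refl refl (λ { (suc i) _ → refl }) , refl , refl

IsUnitTop-∏ : ∀ (Φ : ℕ → Poly) ds {s} → IsUnitTop (∏ (map Φ ds)) s →
  s ≡ ∑ (unitTop ∘ Φ) ds
IsUnitTop-∏ Φ []       Ts = IsUnitTop-unique Ts IsUnitTop-one
IsUnitTop-∏ Φ (d ∷ ds) Ts
  with s , t , Td , Tds , refl ← IsUnitTop-⊠ (Φ d) (∏ (map Φ ds)) Ts =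
  cong₂ ℤ._+_ (sym (unitTop-correct Td)) (IsUnitTop-∏ Φ ds Tds)

X^-Top : ∀ k → Top k 1ℤ 0ℤ (X^ k)
X^-Top zero = mkTop refl refl λ { (suc i) _ → refl }
X^-Top (suc k) with X^-Top k
... | mkTop l n z = mkTop l (pre k) λ { (suc i) (s≤s k<i) → z i k<i }
  where
  pre : ∀ k → coeff (X^ (suc k)) k ≡ 0ℤ
  pre zero    = refl
  pre (suc k) = pre k

-- For k ≥ 1 this is minus the indicator of k = 1, the divisor sum of -μ: only in x - 1 does the
-- constant term sit next to the leading one.
next[X^_-1] : ℕ → ℤ
next[X^ 1 -1] = -1ℤ
next[X^ _ -1] = 0ℤ

X^k-1-unitTop : ∀ k → 1 ℕ.≤ k → IsUnitTop ((X^ k) ⊟ one) next[X^ k -1]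
X^k-1-unitTop (suc k) _ =
  suc k , 1ℤ , next[X^ suc k -1]
  , mkTop (trans (coeff-⊟ (X^ suc k) one (suc k)) (cong (ℤ._- 0ℤ) (Top.leading T)))
          (trans (coeff-⊟ (X^ suc k) one k)
                 (trans (cong (ℤ._- coeff one k) (Top.next T)) (second k)))
          (λ { (suc i) k<i → trans (coeff-⊟ (X^ suc k) one (suc i))
                                   (cong (ℤ._- 0ℤ) (Top.above T _ k<i)) })
  , refl , ℤ.*-identityʳ _
  where
  T : Top (suc k) 1ℤ 0ℤ (X^ suc k)
  T = X^-Top (suc k)
  second : ∀ k → 0ℤ - coeff one k ≡ next[X^ suc k -1]
  second zero    = refl
  second (suc _) = refl

-- Sums over divisors

∈-divisors⁺ : ∀ {d n} .{{_ : NonZero n}} → d ∣ n → d ∈ divisors n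
∈-divisors⁺ {zero}  {n}     0∣n with () ← ℕ.≢-nonZero⁻¹ n (0∣⇒≡0 0∣n)
∈-divisors⁺ {suc d} {n}     d∣n =
  ∈-filter⁺ (_∣? n) (∈-map⁺ suc (∈-upTo⁺ (∣⇒≤ d∣n))) d∣n

∈-divisors⁻ : ∀ {d} n → d ∈ divisors n → d ∣ n
∈-divisors⁻ n d∈ = proj₂ (∈-filter⁻ (_∣? n) {xs = map suc (upTo n)} d∈)

divisors-unique : ∀ n → Unique (divisors n)
divisors-unique n = Unique.filter⁺ (_∣? n) (Unique.map⁺ ℕ.suc-injective (Unique.upTo⁺ n))

unique⇒↭ : ∀ {xs ys : List ℕ} → Unique xs → Unique ys →
  (∀ {d} → d ∈ xs ⇔ d ∈ ys) → xs ↭ ys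
unique⇒↭ uxs uys same = ∼bag⇒↭ (unique∧set⇒bag uxs uys same)

divisors-∤ : ℕ → ℕ → List ℕ
divisors-∤ n m = filter (λ d → ¬? (d ∣? m)) (divisors n)

divisors-split : ∀ {m n} .{{_ : NonZero m}} .{{_ : NonZero n}} → m ∣ n →
  divisors n ↭ divisors m ++ divisors-∤ n m
divisors-split {m} {n} m∣n = unique⇒↭ (divisors-unique n)
  (Unique.++⁺ (divisors-unique m) (Unique.filter⁺ ∤m? (divisors-unique n))
    λ (d∈ , d∈′) → proj₂ (∈-filter⁻ ∤m? {xs = divisors n} d∈′) (∈-divisors⁻ m d∈))
  (mk⇔ to from)
  where
  ∤m? = λ d → ¬? (d ∣? m)
  to : ∀ {d} → d ∈ divisors n → d ∈ divisors m ++ divisors-∤ n m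
  to {d} d∈ with d ∣? m
  ... | yes d∣m = ∈-++⁺ˡ (∈-divisors⁺ d∣m)
  ... | no  d∤m = ∈-++⁺ʳ (divisors m) (∈-filter⁺ ∤m? d∈ d∤m)
  from : ∀ {d} → d ∈ divisors m ++ divisors-∤ n m → d ∈ divisors n
  from d∈ with ∈-++⁻ (divisors m) d∈
  ... | inj₁ d∈m = ∈-divisors⁺ (∣-trans (∈-divisors⁻ m d∈m) m∣n)
  ... | inj₂ d∈n = proj₁ (∈-filter⁻ ∤m? d∈n)

prime∤⇒coprime : ∀ {p d} → Prime p → ¬ (p ∣ d) → Coprime d p
prime∤⇒coprime pr p∤d (i∣d , i∣p) with prime⇒irreducible pr i∣p
... | inj₁ i≡1  = i≡1
... | inj₂ refl = ⊥-elim (p∤d i∣d)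

∤⇒prime∣ : ∀ {p d} n → Prime p → d ∣ p ℕ.* n → ¬ (d ∣ n) → p ∣ d
∤⇒prime∣ {p} {d} n pr d∣pn d∤n with p ∣? d
... | yes p∣d = p∣d
... | no  p∤d = ⊥-elim (d∤n (coprime-divisor (prime∤⇒coprime pr p∤d) d∣pn))

divisors-*-coprime : ∀ {p n} .{{_ : NonZero n}} → Prime p → ¬ (p ∣ n) →
  divisors (p ℕ.* n) ↭ divisors n ++ map (p ℕ.*_) (divisors n)
divisors-*-coprime {p} {n} pr p∤n = unique⇒↭ (divisors-unique (p ℕ.* n))
  (Unique.++⁺ (divisors-unique n)
    (Unique.map⁺ (ℕ.*-cancelˡ-≡ _ _ p) (divisors-unique n))
    λ (d∈ , d∈′) → p∤n (∣-trans (p∣ d∈′) (∈-divisors⁻ n d∈)))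
  (mk⇔ to from)
  where
  instance
    p≢0 = prime⇒nonZero pr
    pn≢0 = ℕ.m*n≢0 p n
  p∣ : ∀ {d} → d ∈ map (p ℕ.*_) (divisors n) → p ∣ d
  p∣ d∈ with e , _ , refl ← ∈-map⁻ (p ℕ.*_) d∈ = m∣m*n e
  to : ∀ {d} → d ∈ divisors (p ℕ.* n) → d ∈ divisors n ++ map (p ℕ.*_) (divisors n)
  to {d} d∈ with d ∣? n
  ... | yes d∣n = ∈-++⁺ˡ (∈-divisors⁺ d∣n)
  ... | no  d∤n with divides e refl ← ∤⇒prime∣ n pr (∈-divisors⁻ (p ℕ.* n) d∈) d∤n =
    ∈-++⁺ʳ (divisors n)
      (subst (_∈ map (p ℕ.*_) (divisors n)) (ℕ.*-comm p e)
        (∈-map⁺ (p ℕ.*_) (∈-divisors⁺ (*-cancelˡ-∣ p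
          (subst (_∣ p ℕ.* n) (ℕ.*-comm e p) (∈-divisors⁻ (p ℕ.* n) d∈))))))
  from : ∀ {d} → d ∈ divisors n ++ map (p ℕ.*_) (divisors n) → d ∈ divisors (p ℕ.* n)
  from d∈ with ∈-++⁻ (divisors n) d∈
  ... | inj₁ d∈n = ∈-divisors⁺ (∣-trans (∈-divisors⁻ n d∈n) (n∣m*n p))
  ... | inj₂ d∈p with e , e∈ , refl ← ∈-map⁻ (p ℕ.*_) d∈p =
    ∈-divisors⁺ (*-monoʳ-∣ p (∈-divisors⁻ n e∈))

∑-++ : ∀ f xs ys → ∑ f (xs ++ ys) ≡ ∑ f xs ℤ.+ ∑ f ys
∑-++ f []       ys = sym (ℤ.+-identityˡ _)
∑-++ f (x ∷ xs) ys = trans (cong (ℤ._+_ (f x)) (∑-++ f xs ys)) (sym (ℤ.+-assoc (f x) _ _))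

∑-map : ∀ f (g : ℕ → ℕ) xs → ∑ f (map g xs) ≡ ∑ (f ∘ g) xs
∑-map f g []       = refl
∑-map f g (x ∷ xs) = cong (ℤ._+_ (f (g x))) (∑-map f g xs)

∑-+ : ∀ f g xs → ∑ (λ x → f x ℤ.+ g x) xs ≡ ∑ f xs ℤ.+ ∑ g xs
∑-+ f g []       = refl
∑-+ f g (x ∷ xs) =
  trans (cong (ℤ._+_ (f x ℤ.+ g x)) (∑-+ f g xs)) (lemma (f x) (g x) _ _)
  where
  lemma : ∀ a b c d → (a ℤ.+ b) ℤ.+ (c ℤ.+ d) ≡ (a ℤ.+ c) ℤ.+ (b ℤ.+ d)
  lemma = solve-∀

∑-↭ : ∀ f {xs ys} → xs ↭ ys → ∑ f xs ≡ ∑ f ys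
∑-↭ f ↭.refl        = refl
∑-↭ f (↭.prep x p)  = cong (ℤ._+_ (f x)) (∑-↭ f p)
∑-↭ f (↭.swap {xs} {ys} x y p) =
  trans (cong (λ s → f x ℤ.+ (f y ℤ.+ s)) (∑-↭ f p)) (lemma (f x) (f y) (∑ f ys))
  where
  lemma : ∀ a b c → a ℤ.+ (b ℤ.+ c) ≡ b ℤ.+ (a ℤ.+ c)
  lemma = solve-∀
∑-↭ f (↭.trans p q) = trans (∑-↭ f p) (∑-↭ f q)

∑-zero : ∀ f xs → (∀ {d} → d ∈ xs → f d ≡ 0ℤ) → ∑ f xs ≡ 0ℤ
∑-zero f []       _  = refl
∑-zero f (x ∷ xs) f0 = cong₂ ℤ._+_ (f0 (here refl)) (∑-zero f xs (f0 ∘ there))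

∑-single : ∀ f {x xs} → Unique xs → x ∈ xs →
  (∀ {d} → d ∈ xs → d ≢ x → f d ≡ 0ℤ) → ∑ f xs ≡ f x
∑-single f {x} {_ ∷ xs} (x∉ ∷ _) (here refl) f0 =
  trans (cong (ℤ._+_ (f x)) (∑-zero f xs λ d∈ → f0 (there d∈) (λ d≡x → All.lookup x∉ d∈ (sym d≡x))))
        (ℤ.+-identityʳ _)
∑-single f (y∉ ∷ u) (there x∈) f0 =
  trans (cong₂ ℤ._+_ (f0 (here refl) (All.lookup y∉ x∈)) (∑-single f u x∈ (f0 ∘ there)))
        (ℤ.+-identityˡ _)

-- The Möbius function, up to sign, from its divisor sums

module _ (f : ℕ → ℤ) (∑f≡ : ∀ k → 1 ℕ.≤ k → ∑ f (divisors k) ≡ next[X^ k -1]) where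

  ∑f≡0 : ∀ k .{{_ : NonZero k}} → k ≢ 1 → ∑ f (divisors k) ≡ 0ℤ
  ∑f≡0 0             _   = refl
  ∑f≡0 1             k≢1 = ⊥-elim (k≢1 refl)
  ∑f≡0 (suc (suc k)) _   = ∑f≡ (suc (suc k)) (s≤s z≤n)

  prime*n≢1 : ∀ {p} n → Prime p → p ℕ.* n ≢ 1
  prime*n≢1 {p} n pr pn≡1 with refl ← ℕ.m*n≡1⇒m≡1 p n pn≡1 with () ← prime⇒nonTrivial pr

  -- The divisors of pn are the d and the pd with d ∣ n, so the sums f(d) + f(pd) over d ∣ n add up
  -- to 0. By induction all of them with d < n vanish, leaving the one for d = n.
  f[p*n]+f[n]≡0 : ∀ {p} → Prime p → ∀ n → .{{_ : NonZero n}} → ¬ (p ∣ n) →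
    f n ℤ.+ f (p ℕ.* n) ≡ 0ℤ
  f[p*n]+f[n]≡0 {p} pr = <-rec _ step
    where
    g : ℕ → ℤ
    g d = f d ℤ.+ f (p ℕ.* d)
    step : ∀ n → (∀ {d} → d ℕ.< n → .{{_ : NonZero d}} → ¬ (p ∣ d) → g d ≡ 0ℤ) →
           .{{_ : NonZero n}} → ¬ (p ∣ n) → g n ≡ 0ℤ
    step n IH p∤n = begin
      g n
        ≡⟨ ∑-single g (divisors-unique n) (∈-divisors⁺ ∣-refl) smaller ⟨
      ∑ g (divisors n)
        ≡⟨ ∑-+ f (f ∘ (p ℕ.*_)) (divisors n) ⟩
      ∑ f (divisors n) ℤ.+ ∑ (f ∘ (p ℕ.*_)) (divisors n)
        ≡⟨ cong (ℤ._+_ (∑ f (divisors n))) (∑-map f (p ℕ.*_) (divisors n)) ⟨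
      ∑ f (divisors n) ℤ.+ ∑ f (map (p ℕ.*_) (divisors n))
        ≡⟨ ∑-++ f (divisors n) _ ⟨
      ∑ f (divisors n ++ map (p ℕ.*_) (divisors n))
        ≡⟨ ∑-↭ f (divisors-*-coprime pr p∤n) ⟨
      ∑ f (divisors (p ℕ.* n))
        ≡⟨ ∑f≡0 (p ℕ.* n) {{ℕ.m*n≢0 p n {{prime⇒nonZero pr}}}} (prime*n≢1 n pr) ⟩
      0ℤ ∎
      where
      open ≡-Reasoning
      smaller : ∀ {d} → d ∈ divisors n → d ≢ n → g d ≡ 0ℤ
      smaller {zero}  0∈ _   with () ← ℕ.≢-nonZero⁻¹ n (0∣⇒≡0 (∈-divisors⁻ n 0∈))
      smaller {suc d} d∈ d≢n =
        IH (ℕ.≤∧≢⇒< (∣⇒≤ d∣n) d≢n) (λ p∣d → p∤n (∣-trans p∣d d∣n))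
        where d∣n = ∈-divisors⁻ n d∈

  -- Since p ∣ n, both n and pn differ from 1, so the divisor sums of both vanish and f sums to 0
  -- over the divisors of pn that do not divide n. These are of the form pe with p ∣ e ∣ n;
  -- induction removes all but pn.
  f[p*n]≡0 : ∀ {p} → Prime p → ∀ n → .{{_ : NonZero n}} → p ∣ n → f (p ℕ.* n) ≡ 0ℤ
  f[p*n]≡0 {p} pr = <-rec _ step
    where
    instance
      p≢0 = prime⇒nonZero pr
    step : ∀ n → (∀ {d} → d ℕ.< n → .{{_ : NonZero d}} → p ∣ d → f (p ℕ.* d) ≡ 0ℤ) →
           .{{_ : NonZero n}} → p ∣ n → f (p ℕ.* n) ≡ 0ℤ
    step n IH p∣n@(divides m n≡mp) = begin
      f (p ℕ.* n)
        ≡⟨ ∑-single f (Unique.filter⁺ ∤n? (divisors-unique (p ℕ.* n)))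
             (∈-filter⁺ ∤n? (∈-divisors⁺ ∣-refl) pn∤n) smaller ⟨
      ∑ f (divisors-∤ (p ℕ.* n) n)
        ≡⟨ ℤ.+-identityˡ _ ⟨
      0ℤ ℤ.+ ∑ f (divisors-∤ (p ℕ.* n) n)
        ≡⟨ cong (ℤ._+ ∑ f (divisors-∤ (p ℕ.* n) n)) (∑f≡0 n n≢1) ⟨
      ∑ f (divisors n) ℤ.+ ∑ f (divisors-∤ (p ℕ.* n) n)
        ≡⟨ ∑-++ f (divisors n) _ ⟨
      ∑ f (divisors n ++ divisors-∤ (p ℕ.* n) n)
        ≡⟨ ∑-↭ f (divisors-split (n∣m*n p)) ⟨
      ∑ f (divisors (p ℕ.* n))
        ≡⟨ ∑f≡0 (p ℕ.* n) (prime*n≢1 n pr) ⟩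
      0ℤ ∎
      where
      open ≡-Reasoning
      instance
        pn≢0 = ℕ.m*n≢0 p n
      ∤n? = λ d → ¬? (d ∣? n)
      n≢1 : n ≢ 1
      n≢1 n≡1 = prime*n≢1 m pr (trans (ℕ.*-comm p m) (trans (sym n≡mp) n≡1))
      pn∤n : ¬ (p ℕ.* n ∣ n)
      pn∤n pn∣n = ℕ.<⇒≱ (subst (n ℕ.<_) (ℕ.*-comm n p) (ℕ.m<m*n n p (ℕ.nonTrivial⇒n>1 p {{prime⇒nonTrivial pr}}))) (∣⇒≤ pn∣n)
      smaller : ∀ {d} → d ∈ divisors-∤ (p ℕ.* n) n → d ≢ p ℕ.* n → f d ≡ 0ℤ
      smaller {d} d∈ d≢pn
        with d∈pn , d∤n ← ∈-filter⁻ ∤n? {xs = divisors (p ℕ.* n)} d∈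
        with d∣pn ← ∈-divisors⁻ (p ℕ.* n) d∈pn
        with divides e refl ← ∤⇒prime∣ n pr d∣pn d∤n =
        trans (cong f (ℕ.*-comm e p))
          (IH {e} (ℕ.≤∧≢⇒< (∣⇒≤ e∣n) λ { refl → d≢pn (ℕ.*-comm e p) }) {{e≢0}} p∣e)
        where
        e∣n : e ∣ n
        e∣n = *-cancelˡ-∣ p (subst (_∣ p ℕ.* n) (ℕ.*-comm e p) d∣pn)
        e≢0 : NonZero e
        e≢0 = ℕ.≢-nonZero λ { refl → ℕ.≢-nonZero⁻¹ n (0∣⇒≡0 e∣n) }
        -- As d = ep does not divide n = mp, e does not divide m; but e divides pm, which forces p ∣
        -- e.
        p∣e : p ∣ e
        p∣e = ∤⇒prime∣ m pr (subst (e ∣_) (trans n≡mp (ℕ.*-comm m p)) e∣n)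
                (λ e∣m → d∤n (subst (e ℕ.* p ∣_) (sym n≡mp) (*-monoˡ-∣ p e∣m)))

  -- Peeling a prime p off n = pm gives 0 if p ∣ m and -f(m) otherwise.
  f-values : ∀ n → .{{_ : NonZero n}} → f n ≡ -1ℤ ⊎ f n ≡ 0ℤ ⊎ f n ≡ 1ℤ
  f-values = <-rec _ step
    where
    step : ∀ n → (∀ {m} → m ℕ.< n → .{{_ : NonZero m}} → f m ≡ -1ℤ ⊎ f m ≡ 0ℤ ⊎ f m ≡ 1ℤ) →
           .{{_ : NonZero n}} → f n ≡ -1ℤ ⊎ f n ≡ 0ℤ ⊎ f n ≡ 1ℤ
    step n IH with factorise n
    ... | record { factors = [] ; isFactorisation = refl } =
      inj₁ (trans (sym (ℤ.+-identityʳ _)) (∑f≡ 1 (s≤s z≤n)))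
    ... | record { factors = p ∷ ps ; isFactorisation = n≡pm ; factorsPrime = pr ∷ _ } =
      subst (λ k → f k ≡ -1ℤ ⊎ f k ≡ 0ℤ ⊎ f k ≡ 1ℤ) (sym n≡pm) f[pm]
      where
      m = product ps
      instance
        m≢0 : NonZero m
        m≢0 = ℕ.≢-nonZero λ m≡0 →
          ℕ.≢-nonZero⁻¹ n (trans n≡pm (trans (cong (p ℕ.*_) m≡0) (ℕ.*-zeroʳ p)))
      m<n : m ℕ.< n
      m<n = subst (m ℕ.<_) (trans (ℕ.*-comm m p) (sym n≡pm))
              (ℕ.m<m*n m p (ℕ.nonTrivial⇒n>1 p {{prime⇒nonTrivial pr}}))
      negate : ∀ {x y} → x ℤ.+ y ≡ 0ℤ → x ≡ -1ℤ ⊎ x ≡ 0ℤ ⊎ x ≡ 1ℤ → y ≡ -1ℤ ⊎ y ≡ 0ℤ ⊎ y ≡ 1ℤ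
      negate {x} {y} x+y≡0 x-values with refl ← inverseʳ-unique x y x+y≡0 with x-values
      ... | inj₁ refl        = inj₂ (inj₂ refl)
      ... | inj₂ (inj₁ refl) = inj₂ (inj₁ refl)
      ... | inj₂ (inj₂ refl) = inj₁ refl
      f[pm] : f (p ℕ.* m) ≡ -1ℤ ⊎ f (p ℕ.* m) ≡ 0ℤ ⊎ f (p ℕ.* m) ≡ 1ℤ
      f[pm] with p ∣? m
      ... | yes p∣m = inj₂ (inj₁ (f[p*n]≡0 pr m p∣m))
      ... | no  p∤m = negate (f[p*n]+f[n]≡0 pr m p∤m) (IH m<n)

-- Second coefficients of companion and cyclotomic polynomials

expansionPoly-Top : ∀ c k → Top (suc k) 1ℤ (ℤ.- c 1) (expansionPoly c (suc k))
expansionPoly-Top c zero    = mkTop refl refl λ { (suc (suc i)) _ → refl ; (suc zero) (s≤s ()) }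
expansionPoly-Top c (suc k) with expansionPoly-Top c k
... | mkTop l n z = mkTop l n λ { (suc i) (s≤s k<i) → z i k<i }

-- Such a coefficient is the leading 1 or a 0 beyond it. Stating only its sign lets period 1 and
-- longer periods be treated alike.
expansionPoly-≥0 : ∀ c k i → k ℕ.≤ i → 0ℤ ≤ coeff (expansionPoly c k) i
expansionPoly-≥0 c zero    zero    _         = ℤ.+≤+ z≤n
expansionPoly-≥0 c zero    (suc i) _         = ℤ.≤-refl
expansionPoly-≥0 c (suc k) (suc i) (s≤s k≤i) = expansionPoly-≥0 c k i k≤i

expansionPoly-above : ∀ c k i → k ℕ.< i → coeff (expansionPoly c k) i ≡ 0ℤ
expansionPoly-above c zero    (suc i) _         = refl
expansionPoly-above c (suc k) (suc i) (s≤s k<i) = expansionPoly-above c k i k<i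

-- The term -c₁ comes from P_{m+p}. The subtracted P_m reaches degree m + p - 1 only for p = 1, with
-- its leading 1; so x is 1 for p = 1 and 0 otherwise.
companion-unitTop : ∀ c m p → 1 ℕ.≤ p →
  ∃[ x ] (0ℤ ≤ x × IsUnitTop (companion c m p) (ℤ.- c 1 - x))
companion-unitTop c m (suc p) _ rewrite ℕ.+-suc m p =
    coeff (expansionPoly c m) (m ℕ.+ p)
  , expansionPoly-≥0 c m _ m≤m+p
  , suc (m ℕ.+ p) , 1ℤ , _
  , mkTop (trans (coeff-⊟ f g _) (cong₂ _-_ (Top.leading T) (g≡0 _ ℕ.≤-refl)))
          (trans (coeff-⊟ f g _) (cong (_- coeff g (m ℕ.+ p)) (Top.next T)))
          (λ i <i → trans (coeff-⊟ f g i) (cong₂ _-_ (Top.above T i <i) (g≡0 i (ℕ.<⇒≤ <i))))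
  , refl , ℤ.*-identityʳ _
  where
  f = expansionPoly c (suc (m ℕ.+ p))
  g = expansionPoly c m
  T = expansionPoly-Top c (m ℕ.+ p)
  m≤m+p = ℕ.m≤m+n m p
  g≡0 : ∀ i → suc (m ℕ.+ p) ℕ.≤ i → coeff g i ≡ 0ℤ
  g≡0 i <i = expansionPoly-above c m i (ℕ.≤-trans (s≤s m≤m+p) <i)

-- This is μ(n) ≤ 1, since s = -μ(n).
cyclotomic-unitTop : ∀ {n Q} → 1 ℕ.≤ n → IsCyclotomic n Q → ∀ {s} → IsUnitTop Q s → -1ℤ ≤ s
cyclotomic-unitTop {n@(suc _)} _ (Φ , ∏Φ , Q≋Φn) Qs =
  subst (-1ℤ ≤_) (unitTop-correct {Φ n} (IsUnitTop-resp-≋ Q≋Φn Qs))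
    (bounded (f-values (unitTop ∘ Φ) ∑≡ n))
  where
  ∑≡ : ∀ k → 1 ℕ.≤ k → ∑ (unitTop ∘ Φ) (divisors k) ≡ next[X^ k -1]
  ∑≡ k 1≤k = sym (IsUnitTop-∏ Φ (divisors k)
    (IsUnitTop-resp-≋ (λ i → sym (∏Φ k 1≤k i)) (X^k-1-unitTop k 1≤k)))
  bounded : ∀ {s} → s ≡ -1ℤ ⊎ s ≡ 0ℤ ⊎ s ≡ 1ℤ → -1ℤ ≤ s
  bounded (inj₁ refl)        = ℤ.≤-refl
  bounded (inj₂ (inj₁ refl)) = ℤ.-≤+
  bounded (inj₂ (inj₂ refl)) = ℤ.-≤+

-- Comparing second coefficients gives -c₁ - x = a + t with x ≥ 0 from the companion polynomial and
-- t ≥ -1 from Q, both of which push c₁ down.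
first-digit-bound : ∀ {n P Q d a} c m p → 1 ℕ.≤ n → IsCyclotomic n Q → Top d 1ℤ a P →
  1 ℕ.≤ p → companion c m p ≋ P ⊠ Q → c 1 ≤ 1ℤ - a
first-digit-bound {n} {P} {Q} {d} {a} c m p 1≤n Qn TP 1≤p R≋PQ
  with x , 0≤x , R-c₁-x ← companion-unitTop c m p 1≤p
  with s , t , Ps , Qt , eq ← IsUnitTop-⊠ P Q (IsUnitTop-resp-≋ R≋PQ R-c₁-x)
  with refl ← IsUnitTop-unique Ps (d , 1ℤ , a , TP , refl , ℤ.*-identityʳ a) =
  ℤ.0≤i-j⇒j≤i (subst (0ℤ ≤_) (sym gap)
    (ℤ.+-mono-≤ (ℤ.i≤j⇒0≤j-i (cyclotomic-unitTop 1≤n Qn Qt)) 0≤x))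
  where
  open ≡-Reasoning
  lemma₁ : ∀ a c₁ x → (1ℤ - a) - c₁ ≡ (1ℤ - a) ℤ.+ x ℤ.+ (ℤ.- c₁ - x)
  lemma₁ = solve-∀
  lemma₂ : ∀ a x t → (1ℤ - a) ℤ.+ x ℤ.+ (a ℤ.+ t) ≡ (t - -1ℤ) ℤ.+ x
  lemma₂ = solve-∀
  gap : (1ℤ - a) - c 1 ≡ (t - -1ℤ) ℤ.+ x
  gap = begin
    (1ℤ - a) - c 1                      ≡⟨ lemma₁ a (c 1) x ⟩
    (1ℤ - a) ℤ.+ x ℤ.+ (ℤ.- c 1 - x)    ≡⟨ cong (λ y → (1ℤ - a) ℤ.+ x ℤ.+ y) eq ⟩
    (1ℤ - a) ℤ.+ x ℤ.+ (a ℤ.+ t)        ≡⟨ lemma₂ a x t ⟩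
    (t - -1ℤ) ℤ.+ x                     ∎

-- Evaluation at rationals and bisection

ℤ→ℚ≡fromℤ : ∀ z → ℤ→ℚ z ≡ ℚ.fromℤ z
ℤ→ℚ≡fromℤ z = ℚ.↥p/↧p≡p (ℚ.fromℤ z)

ℤ→ℚ-mono-≤ : ∀ {x y} → x ≤ y → ℤ→ℚ x ℚ.≤ ℤ→ℚ y
ℤ→ℚ-mono-≤ {x} {y} x≤y rewrite ℤ→ℚ≡fromℤ x | ℤ→ℚ≡fromℤ y =
  ℚ.*≤* (ℤ.*-monoʳ-≤-nonNeg 1ℤ x≤y)

0≤ℤ→ℚ : ∀ n → 0ℚ ℚ.≤ ℤ→ℚ (+ n)
0≤ℤ→ℚ n = ℤ→ℚ-mono-≤ (ℤ.+≤+ (z≤n {n}))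

ℤ→ℚ-+ : ∀ x y → ℤ→ℚ (x ℤ.+ y) ≡ ℤ→ℚ x ℚ.+ ℤ→ℚ y
ℤ→ℚ-+ x y rewrite ℤ→ℚ≡fromℤ x | ℤ→ℚ≡fromℤ y =
  cong (ℚ._/ 1) (sym (cong₂ ℤ._+_ (ℤ.*-identityʳ x) (ℤ.*-identityʳ y)))

ℤ→ℚ-* : ∀ x y → ℤ→ℚ (x * y) ≡ ℤ→ℚ x ℚ.* ℤ→ℚ y
ℤ→ℚ-* x y rewrite ℤ→ℚ≡fromℤ x | ℤ→ℚ≡fromℤ y = refl

ℤ→ℚ-neg : ∀ x → ℤ→ℚ (ℤ.- x) ≡ ℚ.- ℤ→ℚ x
ℤ→ℚ-neg x rewrite ℤ→ℚ≡fromℤ x = trans (ℤ→ℚ≡fromℤ (ℤ.- x)) (fromℤ-neg x)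
  where
  fromℤ-neg : ∀ x → ℚ.fromℤ (ℤ.- x) ≡ ℚ.- ℚ.fromℤ x
  fromℤ-neg (+ zero)   = refl
  fromℤ-neg (+ suc n)  = refl
  fromℤ-neg ℤ.-[1+ n ] = refl

ℤ→ℚ-- : ∀ x y → ℤ→ℚ (x - y) ≡ ℤ→ℚ x ℚ.- ℤ→ℚ y
ℤ→ℚ-- x y = trans (ℤ→ℚ-+ x (ℤ.- y)) (cong (ℚ._+_ (ℤ→ℚ x)) (ℤ→ℚ-neg y))

archimedean : ∀ q → ∃[ n ] q ℚ.≤ ℤ→ℚ (+ n)
archimedean q@(ℚ.mkℚ z d _) = ℤ.∣ z ∣ , subst (q ℚ.≤_) (sym (ℤ→ℚ≡fromℤ (+ ℤ.∣ z ∣)))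
  (ℚ.*≤* (begin
    z * 1ℤ                       ≡⟨ ℤ.*-identityʳ z ⟩
    z                            ≤⟨ i≤∣i∣ z ⟩
    + ℤ.∣ z ∣                    ≤⟨ ℤ.+≤+ (ℕ.m≤m*n ℤ.∣ z ∣ (suc d)) ⟩
    + (ℤ.∣ z ∣ ℕ.* suc d)        ≡⟨ ℤ.pos-* ℤ.∣ z ∣ (suc d) ⟩
    + ℤ.∣ z ∣ * + suc d          ∎))
  where
  open ℤ.≤-Reasoning
  i≤∣i∣ : ∀ i → i ≤ + ℤ.∣ i ∣
  i≤∣i∣ (+ n)       = ℤ.≤-refl
  i≤∣i∣ ℤ.-[1+ n ]  = ℤ.-≤+

infixl 6 _⊕_
infixl 7 _⊗_

_⊕_ : ∀ {p q} → 0ℚ ℚ.≤ p → 0ℚ ℚ.≤ q → 0ℚ ℚ.≤ p ℚ.+ q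
_⊕_ = ℚ.+-mono-≤

_⊗_ : ∀ {p q} → 0ℚ ℚ.≤ p → 0ℚ ℚ.≤ q → 0ℚ ℚ.≤ p ℚ.* q
_⊗_ {p} {q} 0≤p 0≤q =
  ℚ.nonNegative⁻¹ _ {{ℚ.nonNeg*nonNeg⇒nonNeg p {{ℚ.nonNegative 0≤p}} q {{ℚ.nonNegative 0≤q}}}}

p≤q⇒0≤q-p : ∀ {p q} → p ℚ.≤ q → 0ℚ ℚ.≤ q ℚ.- p
p≤q⇒0≤q-p {p} {q} p≤q = subst (ℚ._≤ q ℚ.- p) (ℚ.+-inverseʳ p) (ℚ.+-monoˡ-≤ (ℚ.- p) p≤q)

0≤q-p⇒p≤q : ∀ {p q} → 0ℚ ℚ.≤ q ℚ.- p → p ℚ.≤ q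
0≤q-p⇒p≤q {p} {q} 0≤q-p =
  subst₂ ℚ._≤_ (ℚ.+-identityˡ p) (lemma p q) (ℚ.+-monoˡ-≤ p 0≤q-p)
  where
  lemma : ∀ p q → q ℚ.- p ℚ.+ p ≡ q
  lemma = solve 2 (λ p q → q :- p :+ p := q) refl

p≤p+q : ∀ {p q} → 0ℚ ℚ.≤ q → p ℚ.≤ p ℚ.+ q
p≤p+q {p} {q} 0≤q = subst (ℚ._≤ p ℚ.+ q) (ℚ.+-identityʳ p) (ℚ.+-monoʳ-≤ p 0≤q)

q≤p+q : ∀ {p q} → 0ℚ ℚ.≤ p → q ℚ.≤ p ℚ.+ q
q≤p+q {p} {q} 0≤p = subst (ℚ._≤ p ℚ.+ q) (ℚ.+-identityˡ q) (ℚ.+-monoˡ-≤ q 0≤p)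

0≤p⇒0<p+1 : ∀ {p} → 0ℚ ℚ.≤ p → 0ℚ ℚ.< p ℚ.+ 1ℚ
0≤p⇒0<p+1 0≤p = ℚ.+-mono-≤-< 0≤p (ℚ.positive⁻¹ 1ℚ)

∣p∣≤q : ∀ {p q} → ℚ.- q ℚ.≤ p → p ℚ.≤ q → ∣ p ∣ ℚ.≤ q
∣p∣≤q {p} {q} -q≤p p≤q with ℚ.∣p∣≡p∨∣p∣≡-p p
... | inj₁ eq = subst (ℚ._≤ q) (sym eq) p≤q
... | inj₂ eq = subst₂ ℚ._≤_ (sym eq) (neg-involutive q) (ℚ.neg-antimono-≤ -q≤p)

p≤∣p∣ : ∀ p → p ℚ.≤ ∣ p ∣
p≤∣p∣ p with ℚ.≤-total 0ℚ p
... | inj₁ 0≤p = ℚ.≤-reflexive (sym (ℚ.0≤p⇒∣p∣≡p 0≤p))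
... | inj₂ p≤0 = ℚ.≤-trans p≤0 (ℚ.0≤∣p∣ p)

-∣p∣≤p : ∀ p → ℚ.- ∣ p ∣ ℚ.≤ p
-∣p∣≤p p = subst (ℚ.- ∣ p ∣ ℚ.≤_) (neg-involutive p)
  (ℚ.neg-antimono-≤ (subst (ℚ.- p ℚ.≤_) (ℚ.∣-p∣≡∣p∣ p) (p≤∣p∣ (ℚ.- p))))

⟦_⟧ : ℚ[x].Poly → ℚ → ℚ
⟦_⟧ = ℚ[x].eval ℚ.+-*-rawRing (λ q → q)

evalℝ-seq : ∀ f x n → seq (evalℝ f x) n ≡ ⟦ f ⟧ (seq x n)
evalℝ-seq []      x n = refl
evalℝ-seq (a ∷ f) x n = cong (λ y → a ℚ.+ seq x n ℚ.* y) (evalℝ-seq f x n)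

evalℂ-seq : ∀ f x n →
  seq (re (evalℂ f (x +i 0ℝ))) n ≡ ⟦ f ⟧ (seq x n) × seq (im (evalℂ f (x +i 0ℝ))) n ≡ 0ℚ
evalℂ-seq []      x n = refl , refl
evalℂ-seq (a ∷ f) x n with evalℂ f (x +i 0ℝ) | evalℂ-seq f x n
... | u +i v | eqᵘ , eqᵛ rewrite eqᵘ | eqᵛ =
    solve 3 (λ a x y → a :+ (x :* y :- con 0ℚ :* con 0ℚ) := a :+ x :* y) refl a (seq x n) (⟦ f ⟧ (seq x n))
  , solve 2 (λ x y → con 0ℚ :+ (x :* con 0ℚ :+ con 0ℚ :* y) := con 0ℚ) refl (seq x n) (⟦ f ⟧ (seq x n))

∣*∣-mono : ∀ x y {k b} → 0ℚ ℚ.≤ k → ∣ x ∣ ℚ.≤ k → ∣ y ∣ ℚ.≤ b → ∣ x ℚ.* y ∣ ℚ.≤ k ℚ.* b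
∣*∣-mono x y {k} {b} 0≤k x≤k y≤b = begin
  ∣ x ℚ.* y ∣       ≡⟨ ℚ.∣p*q∣≡∣p∣*∣q∣ x y ⟩
  ∣ x ∣ ℚ.* ∣ y ∣   ≤⟨ ℚ.*-monoʳ-≤-nonNeg ∣ y ∣ {{ℚ.∣-∣-nonNeg y}} x≤k ⟩
  k ℚ.* ∣ y ∣       ≤⟨ ℚ.*-monoˡ-≤-nonNeg k {{ℚ.nonNegative 0≤k}} y≤b ⟩
  k ℚ.* b           ∎
  where open ℚ.≤-Reasoning

⟦⟧-bounded : ∀ K → 0ℚ ℚ.≤ K → ∀ f →
  ∃[ B ] (0ℚ ℚ.≤ B × ∀ x → ∣ x ∣ ℚ.≤ K → ∣ ⟦ f ⟧ x ∣ ℚ.≤ B)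
⟦⟧-bounded K 0≤K []      = 0ℚ , ℚ.≤-refl , λ _ _ → ℚ.≤-refl
⟦⟧-bounded K 0≤K (a ∷ f) with ⟦⟧-bounded K 0≤K f
... | B , 0≤B , bound = ∣ a ∣ ℚ.+ K ℚ.* B , ℚ.0≤∣p∣ a ⊕ 0≤K ⊗ 0≤B , λ x x≤K → begin
    ∣ a ℚ.+ x ℚ.* ⟦ f ⟧ x ∣         ≤⟨ ℚ.∣p+q∣≤∣p∣+∣q∣ a _ ⟩
    ∣ a ∣ ℚ.+ ∣ x ℚ.* ⟦ f ⟧ x ∣     ≤⟨ ℚ.+-monoʳ-≤ ∣ a ∣ (∣*∣-mono x _ 0≤K x≤K (bound x x≤K)) ⟩
    ∣ a ∣ ℚ.+ K ℚ.* B               ∎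
  where open ℚ.≤-Reasoning

-- The product rule along Horner's scheme: x u - y v = x (u - v) + v (x - y), where K bounds x and B
-- bounds v.
⟦⟧-lipschitz : ∀ K → 0ℚ ℚ.≤ K → ∀ f →
  ∃[ L ] (0ℚ ℚ.≤ L × ∀ x y → ∣ x ∣ ℚ.≤ K → ∣ y ∣ ℚ.≤ K →
    ∣ ⟦ f ⟧ x ℚ.- ⟦ f ⟧ y ∣ ℚ.≤ L ℚ.* ∣ x ℚ.- y ∣)
⟦⟧-lipschitz K 0≤K []      =
  0ℚ , ℚ.≤-refl , λ x y _ _ → ℚ.≤-reflexive (sym (ℚ.*-zeroˡ ∣ x ℚ.- y ∣))
⟦⟧-lipschitz K 0≤K (a ∷ f) with ⟦⟧-lipschitz K 0≤K f | ⟦⟧-bounded K 0≤K f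
... | L , 0≤L , lip | B , 0≤B , bound =
  K ℚ.* L ℚ.+ B , 0≤K ⊗ 0≤L ⊕ 0≤B , λ x y x≤K y≤K → begin
    ∣ (a ℚ.+ x ℚ.* ⟦ f ⟧ x) ℚ.- (a ℚ.+ y ℚ.* ⟦ f ⟧ y) ∣
      ≡⟨ cong ∣_∣ (split a x y (⟦ f ⟧ x) (⟦ f ⟧ y)) ⟩
    ∣ x ℚ.* (⟦ f ⟧ x ℚ.- ⟦ f ⟧ y) ℚ.+ ⟦ f ⟧ y ℚ.* (x ℚ.- y) ∣
      ≤⟨ ℚ.∣p+q∣≤∣p∣+∣q∣ (x ℚ.* (⟦ f ⟧ x ℚ.- ⟦ f ⟧ y)) _ ⟩
    ∣ x ℚ.* (⟦ f ⟧ x ℚ.- ⟦ f ⟧ y) ∣ ℚ.+ ∣ ⟦ f ⟧ y ℚ.* (x ℚ.- y) ∣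
      ≤⟨ ℚ.+-mono-≤ (∣*∣-mono x _ 0≤K x≤K (lip x y x≤K y≤K))
                    (∣*∣-mono (⟦ f ⟧ y) (x ℚ.- y) 0≤B (bound y y≤K) ℚ.≤-refl) ⟩
    K ℚ.* (L ℚ.* ∣ x ℚ.- y ∣) ℚ.+ B ℚ.* ∣ x ℚ.- y ∣
      ≡⟨ collect K L B ∣ x ℚ.- y ∣ ⟩
    (K ℚ.* L ℚ.+ B) ℚ.* ∣ x ℚ.- y ∣ ∎
  where
  open ℚ.≤-Reasoning
  split : ∀ a x y u v →
    (a ℚ.+ x ℚ.* u) ℚ.- (a ℚ.+ y ℚ.* v) ≡ x ℚ.* (u ℚ.- v) ℚ.+ v ℚ.* (x ℚ.- y)
  split = solve 5 (λ a x y u v →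
    (a :+ x :* u) :- (a :+ y :* v) := x :* (u :- v) :+ v :* (x :- y)) refl
  collect : ∀ K L B d → K ℚ.* (L ℚ.* d) ℚ.+ B ℚ.* d ≡ (K ℚ.* L ℚ.+ B) ℚ.* d
  collect = solve 4 (λ K L B d → K :* (L :* d) :+ B :* d := (K :* L :+ B) :* d) refl

-- The two signs are complementary, so the decidable test at a rational midpoint always selects a
-- half. The strict one, at the upper end, later keeps the root away from that end.
record Bracket (f : ℚ[x].Poly) : Set where
  constructor bracket
  field
    lo width : ℚ
    0≤width  : 0ℚ ℚ.≤ width
    0≤f[lo]  : 0ℚ ℚ.≤ ⟦ f ⟧ lo
    f[hi]<0  : ⟦ f ⟧ (lo ℚ.+ width) ℚ.< 0ℚ

  hi : ℚ
  hi = lo ℚ.+ width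

0≤½ : 0ℚ ℚ.≤ ½
0≤½ = ℚ.nonNegative⁻¹ ½

lo+½+½ : ∀ x w → x ℚ.+ ½ ℚ.* w ℚ.+ ½ ℚ.* w ≡ x ℚ.+ w
lo+½+½ = solve 2 (λ x w → x :+ con ½ :* w :+ con ½ :* w := x :+ w) refl

module _ {f : ℚ[x].Poly} where

  open Bracket

  halve : Bracket f → Bracket f
  halve b with 0ℚ ℚ.≤? ⟦ f ⟧ (lo b ℚ.+ ½ ℚ.* width b)
  ... | yes 0≤mid = bracket _ _ (0≤½ ⊗ 0≤width b) 0≤mid
    (subst (λ x → ⟦ f ⟧ x ℚ.< 0ℚ) (sym (lo+½+½ (lo b) (width b))) (f[hi]<0 b))
  ... | no  mid<0 = bracket (lo b) _ (0≤½ ⊗ 0≤width b) (0≤f[lo] b) (ℚ.≰⇒> mid<0)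

  width-halve : ∀ b → width (halve b) ≡ ½ ℚ.* width b
  width-halve b with 0ℚ ℚ.≤? ⟦ f ⟧ (lo b ℚ.+ ½ ℚ.* width b)
  ... | yes _ = refl
  ... | no  _ = refl

  lo-halve : ∀ b → lo b ℚ.≤ lo (halve b)
  lo-halve b with 0ℚ ℚ.≤? ⟦ f ⟧ (lo b ℚ.+ ½ ℚ.* width b)
  ... | yes _ = p≤p+q (0≤½ ⊗ 0≤width b)
  ... | no  _ = ℚ.≤-refl

  hi-halve : ∀ b → hi (halve b) ℚ.≤ hi b
  hi-halve b with 0ℚ ℚ.≤? ⟦ f ⟧ (lo b ℚ.+ ½ ℚ.* width b)
  ... | yes _ = ℚ.≤-reflexive (lo+½+½ (lo b) (width b))
  ... | no  _ = 0≤q-p⇒p≤q (subst (0ℚ ℚ.≤_) (lemma (lo b) (width b)) (0≤½ ⊗ 0≤width b))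
    where
    lemma : ∀ x w → ½ ℚ.* w ≡ (x ℚ.+ w) ℚ.- (x ℚ.+ ½ ℚ.* w)
    lemma = solve 2 (λ x w → con ½ :* w := (x :+ w) :- (x :+ con ½ :* w)) refl

  halve^ : ℕ → Bracket f → Bracket f
  halve^ zero    b = b
  halve^ (suc n) b = halve (halve^ n b)

  lo-mono : ∀ b {m n} → m ℕ.≤′ n → lo (halve^ m b) ℚ.≤ lo (halve^ n b)
  lo-mono b (ℕ.≤′-reflexive refl) = ℚ.≤-refl
  lo-mono b {n = suc n} (ℕ.≤′-step m≤n) =
    ℚ.≤-trans (lo-mono b m≤n) (lo-halve (halve^ n b))

  hi-antimono : ∀ b {m n} → m ℕ.≤′ n → hi (halve^ n b) ℚ.≤ hi (halve^ m b)
  hi-antimono b (ℕ.≤′-reflexive refl) = ℚ.≤-refl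
  hi-antimono b {n = suc n} (ℕ.≤′-step m≤n) =
    ℚ.≤-trans (hi-halve (halve^ n b)) (hi-antimono b m≤n)

  lo≤hi : ∀ (b : Bracket f) → lo b ℚ.≤ hi b
  lo≤hi b = p≤p+q (0≤width b)

  lo-within : ∀ b {m n} → m ℕ.≤ n →
    lo (halve^ m b) ℚ.≤ lo (halve^ n b) × lo (halve^ n b) ℚ.≤ hi (halve^ m b)
  lo-within b {n = n} m≤n =
    lo-mono b (ℕ.≤⇒≤′ m≤n) , ℚ.≤-trans (lo≤hi (halve^ n b)) (hi-antimono b (ℕ.≤⇒≤′ m≤n))

  -- A weak form of halving, through 2^n ≥ n + 1, which suits the Archimedean property and avoids
  -- powers.
  width-decay : ∀ b n → width (halve^ n b) ℚ.* ℤ→ℚ (+ suc n) ℚ.≤ width b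
  width-decay b zero    = ℚ.≤-reflexive (ℚ.*-identityʳ _)
  width-decay b (suc n) = ℚ.≤-trans (0≤q-p⇒p≤q (subst (0ℚ ℚ.≤_) gap
      (0≤½ ⊗ (0≤width (halve^ n b) ⊗ 0≤ℤ→ℚ n))))
    (width-decay b n)
    where
    lemma : ∀ w k → ½ ℚ.* (w ℚ.* k) ≡ w ℚ.* (1ℚ ℚ.+ k) ℚ.- ½ ℚ.* w ℚ.* (1ℚ ℚ.+ (1ℚ ℚ.+ k))
    lemma = solve 2 (λ w k → con ½ :* (w :* k) :=
      w :* (con 1ℚ :+ k) :- con ½ :* w :* (con 1ℚ :+ (con 1ℚ :+ k))) refl
    gap : ½ ℚ.* (width (halve^ n b) ℚ.* ℤ→ℚ (+ n)) ≡
          width (halve^ n b) ℚ.* ℤ→ℚ (+ suc n) ℚ.- width (halve^ (suc n) b) ℚ.* ℤ→ℚ (+ suc (suc n))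
    gap = trans (lemma (width (halve^ n b)) (ℤ→ℚ (+ n))) (sym (cong₂ ℚ._-_
      (cong (width (halve^ n b) ℚ.*_) (ℤ→ℚ-+ 1ℤ (+ n)))
      (cong₂ ℚ._*_ (width-halve (halve^ n b))
        (trans (ℤ→ℚ-+ 1ℤ (+ suc n)) (cong (ℚ._+_ 1ℚ) (ℤ→ℚ-+ 1ℤ (+ n)))))))

  width→0 : ∀ b ε → 0ℚ ℚ.< ε → ∃[ N ] (∀ n → N ℕ.≤ n → width (halve^ n b) ℚ.< ε)
  width→0 b ε 0<ε =
    -- The added 1 makes the target positive, as `scale` demands, and the final comparison strict.
    let δ , _ , εδ≡w+1 = scale ε (ℚ.positive 0<ε) (width b ℚ.+ 1ℚ) (0≤p⇒0<p+1 (0≤width b))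
        N , δ≤N = archimedean δ
    in N , λ n N≤n → ℚ.*-cancelʳ-<-nonNeg (ℤ→ℚ (+ suc n)) {{ℚ.nonNegative (0≤ℤ→ℚ (suc n))}} (begin-strict
      width (halve^ n b) ℚ.* ℤ→ℚ (+ suc n)  ≤⟨ width-decay b n ⟩
      width b                               <⟨ w<w+1 ⟩
      width b ℚ.+ 1ℚ                        ≡⟨ εδ≡w+1 ⟨
      ε ℚ.* δ                               ≤⟨ ℚ.*-monoˡ-≤-nonNeg ε {{ℚ.nonNegative (ℚ.<⇒≤ 0<ε)}}
                                                 (ℚ.≤-trans δ≤N (ℤ→ℚ-mono-≤ (ℤ.+≤+ (ℕ.m≤n⇒m≤1+n N≤n)))) ⟩
      ε ℚ.* ℤ→ℚ (+ suc n)                   ∎)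
    where
    open ℚ.≤-Reasoning
    w<w+1 : width b ℚ.< width b ℚ.+ 1ℚ
    w<w+1 = subst (ℚ._< width b ℚ.+ 1ℚ) (ℚ.+-identityʳ (width b))
              (ℚ.+-monoʳ-< (width b) (ℚ.positive⁻¹ 1ℚ))

  lo-cauchy : ∀ b → IsCauchy (λ n → lo (halve^ n b))
  lo-cauchy b ε 0<ε =
    let N , small = width→0 b ε 0<ε
    in N , λ m n N≤m N≤n →
      let l₁ , h₁ = lo-within b N≤m
          l₂ , h₂ = lo-within b N≤n
      in ℚ.≤-<-trans (close l₁ h₁ l₂ h₂) (small N ℕ.≤-refl)
    where
    close : ∀ {x w y z} → x ℚ.≤ y → y ℚ.≤ x ℚ.+ w → x ℚ.≤ z → z ℚ.≤ x ℚ.+ w → ∣ y ℚ.- z ∣ ℚ.≤ w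
    close {x} {w} {y} {z} x≤y y≤h x≤z z≤h = ∣p∣≤q
      (0≤q-p⇒p≤q (subst (0ℚ ℚ.≤_) (lemma₁ x w y z) (p≤q⇒0≤q-p x≤y ⊕ p≤q⇒0≤q-p z≤h)))
      (0≤q-p⇒p≤q (subst (0ℚ ℚ.≤_) (lemma₂ x w y z) (p≤q⇒0≤q-p x≤z ⊕ p≤q⇒0≤q-p y≤h)))
      where
      lemma₁ : ∀ x w y z → (y ℚ.- x) ℚ.+ ((x ℚ.+ w) ℚ.- z) ≡ (y ℚ.- z) ℚ.- (ℚ.- w)
      lemma₁ = solve 4 (λ x w y z → (y :- x) :+ ((x :+ w) :- z) := (y :- z) :- (:- w)) refl
      lemma₂ : ∀ x w y z → (z ℚ.- x) ℚ.+ ((x ℚ.+ w) ℚ.- y) ≡ w ℚ.- (y ℚ.- z)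
      lemma₂ = solve 4 (λ x w y z → (z :- x) :+ ((x :+ w) :- y) := w :- (y :- z)) refl

  root : Bracket f → ℝ
  root b = mkℝ (λ n → lo (halve^ n b)) (lo-cauchy b)

  abs-bound : Bracket f → ℚ
  abs-bound b = ∣ lo b ∣ ℚ.+ ∣ hi b ∣

  0≤abs-bound : ∀ b → 0ℚ ℚ.≤ abs-bound b
  0≤abs-bound b = ℚ.0≤∣p∣ (lo b) ⊕ ℚ.0≤∣p∣ (hi b)

  ∣∣≤abs-bound : ∀ (b : Bracket f) {x} → lo b ℚ.≤ x → x ℚ.≤ hi b → ∣ x ∣ ℚ.≤ abs-bound b
  ∣∣≤abs-bound b {x} lo≤x x≤hi = ∣p∣≤q
    (0≤q-p⇒p≤q (subst (0ℚ ℚ.≤_) (lemma₁ x (lo b) ∣ lo b ∣ ∣ hi b ∣)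
      (p≤q⇒0≤q-p lo≤x ⊕ p≤q⇒0≤q-p (-∣p∣≤p (lo b)) ⊕ ℚ.0≤∣p∣ (hi b))))
    (0≤q-p⇒p≤q (subst (0ℚ ℚ.≤_) (lemma₂ x (hi b) ∣ lo b ∣ ∣ hi b ∣)
      (p≤q⇒0≤q-p x≤hi ⊕ p≤q⇒0≤q-p (p≤∣p∣ (hi b)) ⊕ ℚ.0≤∣p∣ (lo b))))
    where
    lemma₁ : ∀ x l u v → (x ℚ.- l) ℚ.+ (l ℚ.- ℚ.- u) ℚ.+ v ≡ x ℚ.- (ℚ.- (u ℚ.+ v))
    lemma₁ = solve 4 (λ x l u v → (x :- l) :+ (l :- :- u) :+ v := x :- (:- (u :+ v))) refl
    lemma₂ : ∀ x h u v → (h ℚ.- x) ℚ.+ (v ℚ.- h) ℚ.+ u ≡ (u ℚ.+ v) ℚ.- x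
    lemma₂ = solve 4 (λ x h u v → (h :- x) :+ (v :- h) :+ u := (u :+ v) :- x) refl

  -- As f(hi) < 0, the nonnegative f(lo) is at most f(lo) - f(hi), which the Lipschitz bound
  -- controls.
  f[lo]≤L*width : ∀ (b : Bracket f) L → 0ℚ ℚ.≤ L →
    ∣ ⟦ f ⟧ (lo b) ℚ.- ⟦ f ⟧ (hi b) ∣ ℚ.≤ L ℚ.* ∣ lo b ℚ.- hi b ∣ →
    ∣ ⟦ f ⟧ (lo b) ℚ.- 0ℚ ∣ ℚ.≤ L ℚ.* width b
  f[lo]≤L*width (bracket x w 0≤w 0≤fx fh<0) L 0≤L lip = begin
    ∣ ⟦ f ⟧ x ℚ.- 0ℚ ∣
      ≡⟨ cong ∣_∣ (ℚ.+-identityʳ (⟦ f ⟧ x)) ⟩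
    ∣ ⟦ f ⟧ x ∣
      ≡⟨ ℚ.0≤p⇒∣p∣≡p 0≤fx ⟩
    ⟦ f ⟧ x
      ≡⟨ ℚ.+-identityʳ (⟦ f ⟧ x) ⟨
    ⟦ f ⟧ x ℚ.+ 0ℚ
      ≤⟨ ℚ.+-monoʳ-≤ (⟦ f ⟧ x) (ℚ.neg-antimono-≤ (ℚ.<⇒≤ fh<0)) ⟩
    ⟦ f ⟧ x ℚ.- ⟦ f ⟧ (x ℚ.+ w)
      ≤⟨ p≤∣p∣ _ ⟩
    ∣ ⟦ f ⟧ x ℚ.- ⟦ f ⟧ (x ℚ.+ w) ∣
      ≤⟨ lip ⟩
    L ℚ.* ∣ x ℚ.- (x ℚ.+ w) ∣
      ≡⟨ cong (L ℚ.*_) (trans (cong ∣_∣ (lemma x w)) (trans (ℚ.∣-p∣≡∣p∣ w) (ℚ.0≤p⇒∣p∣≡p 0≤w))) ⟩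
    L ℚ.* w ∎
    where
    open ℚ.≤-Reasoning
    lemma : ∀ x w → x ℚ.- (x ℚ.+ w) ≡ ℚ.- w
    lemma = solve 2 (λ x w → x :- (x :+ w) := :- w) refl

  f[lo]→0 : ∀ (b : Bracket f) ε → 0ℚ ℚ.< ε →
    ∃[ N ] (∀ n → N ℕ.≤ n → ∣ ⟦ f ⟧ (lo (halve^ n b)) ℚ.- 0ℚ ∣ ℚ.< ε)
  f[lo]→0 b ε 0<ε =
    let L , 0≤L , lip = ⟦⟧-lipschitz (abs-bound b) (0≤abs-bound b) f
        0<L+1 = 0≤p⇒0<p+1 0≤L
        δ , 0<δ , Lδ≡ε = scale (L ℚ.+ 1ℚ) (ℚ.positive 0<L+1) ε 0<ε
        N , small = width→0 b δ 0<δ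
    in N , λ n N≤n →
      let bₙ = halve^ n b
          l , h = lo-within b (z≤n {n})
      in ℚ.≤-<-trans (f[lo]≤L*width bₙ L 0≤L (lip (lo bₙ) (hi bₙ) (∣∣≤abs-bound b l h)
             (∣∣≤abs-bound b (ℚ.≤-trans l (lo≤hi bₙ)) (hi-antimono b (ℕ.≤⇒≤′ (z≤n {n}))))))
           (scaled L (width bₙ) 0<L+1 (0≤width bₙ) (small n N≤n) Lδ≡ε)
    where
    scaled : ∀ L w {δ ε} → 0ℚ ℚ.< L ℚ.+ 1ℚ → 0ℚ ℚ.≤ w → w ℚ.< δ → (L ℚ.+ 1ℚ) ℚ.* δ ≡ ε → L ℚ.* w ℚ.< ε
    scaled L w {δ} {ε} 0<L+1 0≤w w<δ Lδ≡ε = begin-strict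
      L ℚ.* w            ≤⟨ ℚ.*-monoʳ-≤-nonNeg w {{ℚ.nonNegative 0≤w}} (p≤p+q {L} (ℚ.nonNegative⁻¹ 1ℚ)) ⟩
      (L ℚ.+ 1ℚ) ℚ.* w   <⟨ ℚ.*-monoʳ-<-pos (L ℚ.+ 1ℚ) {{ℚ.positive 0<L+1}} w<δ ⟩
      (L ℚ.+ 1ℚ) ℚ.* δ   ≡⟨ Lδ≡ε ⟩
      ε                  ∎
      where
      open ℚ.≤-Reasoning

module _ {f : ℚ[x].Poly} (b : Bracket f) where

  open Bracket

  root-isComplexRoot : evalℂ f (root b +i 0ℝ) ≈ᶜ fromℝ 0ℝ
  root-isComplexRoot =
      (λ ε 0<ε →
        let N , small = f[lo]→0 b ε 0<ε
        in N , λ n N≤n → subst (λ y → ∣ y ℚ.- 0ℚ ∣ ℚ.< ε)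
             (sym (proj₁ (evalℂ-seq f (root b) n))) (small n N≤n))
    , (λ ε 0<ε → 0 , λ n _ → subst (λ y → ∣ y ℚ.- 0ℚ ∣ ℚ.< ε)
         (sym (proj₂ (evalℂ-seq f (root b) n))) 0<ε)

  -- To fall from f ≥ 0 to f(hi) < 0, a Lipschitz f needs a distance of at least -f(hi)/(L + 1),
  -- with L + 1 because L may be 0. The uniform margin matters: a limit α ≤ -1 alone would not
  -- contradict |α| ≤ 1.
  lo-away-from-hi : ∃[ δ ] (0ℚ ℚ.< δ × ∀ n → lo (halve^ n b) ℚ.+ δ ℚ.≤ hi b)
  lo-away-from-hi =
    let L , 0≤L , lip = ⟦⟧-lipschitz (abs-bound b) (0≤abs-bound b) f
        0<L+1 = 0≤p⇒0<p+1 0≤L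
        δ , 0<δ , Lδ≡-f[hi] = scale (L ℚ.+ 1ℚ) (ℚ.positive 0<L+1) _ (ℚ.neg-antimono-< (f[hi]<0 b))
    in δ , 0<δ , λ n →
      let l , h = lo-within b (z≤n {n})
      in separated L δ _ (hi b) 0<L+1 Lδ≡-f[hi] (0≤f[lo] (halve^ n b)) h
           (lip _ (hi b) (∣∣≤abs-bound b l h) (∣∣≤abs-bound b (lo≤hi b) ℚ.≤-refl))
    where
    separated : ∀ L δ x h → 0ℚ ℚ.< L ℚ.+ 1ℚ → (L ℚ.+ 1ℚ) ℚ.* δ ≡ ℚ.- ⟦ f ⟧ h →
      0ℚ ℚ.≤ ⟦ f ⟧ x → x ℚ.≤ h → ∣ ⟦ f ⟧ x ℚ.- ⟦ f ⟧ h ∣ ℚ.≤ L ℚ.* ∣ x ℚ.- h ∣ →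
      x ℚ.+ δ ℚ.≤ h
    separated L δ x h 0<L+1 Lδ≡-fh 0≤fx x≤h lip =
      0≤q-p⇒p≤q (subst (0ℚ ℚ.≤_) (lemma₁ x h δ) (p≤q⇒0≤q-p δ≤h-x))
      where
      open ℚ.≤-Reasoning
      lemma₁ : ∀ x h δ → (h ℚ.- x) ℚ.- δ ≡ h ℚ.- (x ℚ.+ δ)
      lemma₁ = solve 3 (λ x h δ → (h :- x) :- δ := h :- (x :+ δ)) refl
      lemma₂ : ∀ x h → x ℚ.- h ≡ ℚ.- (h ℚ.- x)
      lemma₂ = solve 2 (λ x h → x :- h := :- (h :- x)) refl
      δ≤h-x : δ ℚ.≤ h ℚ.- x
      δ≤h-x = ℚ.*-cancelˡ-≤-pos (L ℚ.+ 1ℚ) {{ℚ.positive 0<L+1}} (begin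
        (L ℚ.+ 1ℚ) ℚ.* δ
          ≡⟨ Lδ≡-fh ⟩
        ℚ.- ⟦ f ⟧ h
          ≡⟨ ℚ.+-identityˡ _ ⟨
        0ℚ ℚ.- ⟦ f ⟧ h
          ≤⟨ ℚ.+-monoˡ-≤ (ℚ.- ⟦ f ⟧ h) 0≤fx ⟩
        ⟦ f ⟧ x ℚ.- ⟦ f ⟧ h
          ≤⟨ p≤∣p∣ _ ⟩
        ∣ ⟦ f ⟧ x ℚ.- ⟦ f ⟧ h ∣
          ≤⟨ lip ⟩
        L ℚ.* ∣ x ℚ.- h ∣
          ≡⟨ cong (L ℚ.*_) (trans (cong ∣_∣ (lemma₂ x h))
               (trans (ℚ.∣-p∣≡∣p∣ (h ℚ.- x)) (ℚ.0≤p⇒∣p∣≡p (p≤q⇒0≤q-p x≤h)))) ⟩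
        L ℚ.* (h ℚ.- x)
          ≤⟨ ℚ.*-monoʳ-≤-nonNeg (h ℚ.- x) {{ℚ.nonNegative (p≤q⇒0≤q-p x≤h)}} (p≤p+q {L} (ℚ.nonNegative⁻¹ 1ℚ)) ⟩
        (L ℚ.+ 1ℚ) ℚ.* (h ℚ.- x) ∎)

-- The reciprocal sextic

sextic : ℚ → ℚ → ℚ → ℚ[x].Poly
sextic a b c = 1ℚ ∷ a ∷ b ∷ c ∷ b ∷ a ∷ 1ℚ ∷ []

2ℚ 3ℚ : ℚ
2ℚ = ℤ→ℚ (+ 2)
3ℚ = ℤ→ℚ (+ 3)

sextic[-1] : ℚ → ℚ → ℚ → ℚ
sextic[-1] a b c = 2ℚ ℚ.- 2ℚ ℚ.* a ℚ.+ 2ℚ ℚ.* b ℚ.- c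

sextic[-1]-correct : ∀ a b c → ⟦ sextic a b c ⟧ (ℚ.- 1ℚ) ≡ sextic[-1] a b c
sextic[-1]-correct = solve 3 (λ a b c → let m = con (ℚ.- 1ℚ) in
  con 1ℚ :+ m :* (a :+ m :* (b :+ m :* (c :+ m :* (b :+ m :* (a :+ m :* (con 1ℚ :+ m :* con 0ℚ))))))
  := con 2ℚ :- con 2ℚ :* a :+ con 2ℚ :* b :- c) refl

-- Rests on P(x) + x³ P(-1) = (x + 1)² (b x² + a x (x - 1)² + (x² - x + 1)²).
x-1≤-sextic : ∀ a b c x → 0ℚ ℚ.≤ x ℚ.- 1ℚ → 0ℚ ℚ.≤ (2ℚ ℚ.* a ℚ.- 3ℚ) ℚ.- b →
  0ℚ ℚ.≤ (2ℚ ℚ.- a) ℚ.- x → 0ℚ ℚ.≤ sextic[-1] a b c →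
  x ℚ.- 1ℚ ℚ.≤ ℚ.- ⟦ sextic a b c ⟧ x
x-1≤-sextic a b c x 0≤y 0≤k 0≤h 0≤v = 0≤q-p⇒p≤q (subst (0ℚ ℚ.≤_) (identity a b c x)
  -- Let k and h be the slacks in b ≤ 2a - 3 and x ≤ 2 - a. The last factor of the identity becomes
  -- 1 - x² - k x² - h x (x² + 1). With y = x - 1, (x + 1)² (x² - 1) - (x - 1) = y ((y + 2)³ - 1),
  -- which is the origin of 6, 12 and 7.
  (0≤y ⊗ (0≤y ⊗ 0≤y ⊗ 0≤y ⊕ 0≤ℤ→ℚ 6 ⊗ (0≤y ⊗ 0≤y) ⊕ 0≤ℤ→ℚ 12 ⊗ 0≤y ⊕ 0≤ℤ→ℚ 7)
   ⊕ (0≤x ⊕ 0≤ℤ→ℚ 1) ⊗ (0≤x ⊕ 0≤ℤ→ℚ 1) ⊗ (0≤k ⊗ (0≤x ⊗ 0≤x) ⊕ 0≤h ⊗ (0≤x ⊗ (0≤x ⊗ 0≤x ⊕ 0≤ℤ→ℚ 1)))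
   ⊕ 0≤x ⊗ 0≤x ⊗ 0≤x ⊗ 0≤v))
  where
  ι : ℕ → ℚ
  ι n = ℤ→ℚ (+ n)
  0≤x : 0ℚ ℚ.≤ x
  0≤x = ℚ.≤-trans (0≤ℤ→ℚ 1) (0≤q-p⇒p≤q 0≤y)
  identity : ∀ a b c x → let y = x ℚ.- 1ℚ ; k = (2ℚ ℚ.* a ℚ.- 3ℚ) ℚ.- b ; h = (2ℚ ℚ.- a) ℚ.- x in
    y ℚ.* (y ℚ.* y ℚ.* y ℚ.+ ι 6 ℚ.* (y ℚ.* y) ℚ.+ ι 12 ℚ.* y ℚ.+ ι 7)
    ℚ.+ (x ℚ.+ ι 1) ℚ.* (x ℚ.+ ι 1) ℚ.* (k ℚ.* (x ℚ.* x) ℚ.+ h ℚ.* (x ℚ.* (x ℚ.* x ℚ.+ ι 1)))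
    ℚ.+ x ℚ.* x ℚ.* x ℚ.* sextic[-1] a b c
    ≡ ℚ.- ⟦ sextic a b c ⟧ x ℚ.- (x ℚ.- 1ℚ)
  identity = solve 4 (λ a b c x →
    let y = x :- con 1ℚ
        k = (con 2ℚ :* a :- con 3ℚ) :- b
        h = (con 2ℚ :- a) :- x
    in
    y :* (y :* y :* y :+ con (ι 6) :* (y :* y) :+ con (ι 12) :* y :+ con (ι 7))
    :+ (x :+ con (ι 1)) :* (x :+ con (ι 1)) :* (k :* (x :* x) :+ h :* (x :* (x :* x :+ con (ι 1))))
    :+ x :* x :* x :* (con 2ℚ :- con 2ℚ :* a :+ con 2ℚ :* b :- c)
    := :- (con 1ℚ :+ x :* (a :+ x :* (b :+ x :* (c :+ x :* (b :+ x :* (a :+ x :* (con 1ℚ :+ x :* con 0ℚ)))))))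
       :- (x :- con 1ℚ)) refl

-- A Cauchy-type root bound: u ≥ 1 + |k| for each of the coefficients k = a, b, c, so in Horner's
-- scheme at -u, with signs alternated, every stage stays at least 1.
sextic[-u]≥0 : ∀ a b c → 0ℚ ℚ.≤ ⟦ sextic a b c ⟧ (ℚ.- (1ℚ ℚ.+ (∣ a ∣ ℚ.+ ∣ b ∣ ℚ.+ ∣ c ∣)))
sextic[-u]≥0 a b c = subst (0ℚ ℚ.≤_) (sym (alternate a b c u)) (ℚ.≤-trans (ℚ.nonNegative⁻¹ 1ℚ)
  (horner 1ℚ _ 1≤u
  (horner (ℚ.- a) _ (coeff-small (ℚ.- a) (ℚ.∣-p∣≡∣p∣ a) a≤)
  (horner b _ (coeff-small b refl b≤)
  (horner (ℚ.- c) _ (coeff-small (ℚ.- c) (ℚ.∣-p∣≡∣p∣ c) c≤)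
  (horner b _ (coeff-small b refl b≤)
  (horner (ℚ.- a) 1ℚ (coeff-small (ℚ.- a) (ℚ.∣-p∣≡∣p∣ a) a≤) ℚ.≤-refl)))))))
  where
  s u : ℚ
  s = ∣ a ∣ ℚ.+ ∣ b ∣ ℚ.+ ∣ c ∣
  u = 1ℚ ℚ.+ s
  alternate : ∀ a b c u → ⟦ sextic a b c ⟧ (ℚ.- u) ≡
    1ℚ ℚ.+ u ℚ.* (ℚ.- a ℚ.+ u ℚ.* (b ℚ.+ u ℚ.* (ℚ.- c ℚ.+ u ℚ.* (b ℚ.+ u ℚ.* (ℚ.- a ℚ.+ u ℚ.* 1ℚ)))))
  alternate = solve 4 (λ a b c u → let m = :- u in
    con 1ℚ :+ m :* (a :+ m :* (b :+ m :* (c :+ m :* (b :+ m :* (a :+ m :* (con 1ℚ :+ m :* con 0ℚ))))))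
    := con 1ℚ :+ u :* (:- a :+ u :* (b :+ u :* (:- c :+ u :* (b :+ u :* (:- a :+ u :* con 1ℚ)))))) refl
  0≤u : 0ℚ ℚ.≤ u
  0≤u = ℚ.nonNegative⁻¹ 1ℚ ⊕ (ℚ.0≤∣p∣ a ⊕ ℚ.0≤∣p∣ b ⊕ ℚ.0≤∣p∣ c)
  horner : ∀ k g → 1ℚ ℚ.- k ℚ.≤ u → 1ℚ ℚ.≤ g → 1ℚ ℚ.≤ k ℚ.+ u ℚ.* g
  horner k g 1-k≤u 1≤g = 0≤q-p⇒p≤q (subst (0ℚ ℚ.≤_) (lemma k g u)
    (p≤q⇒0≤q-p 1-k≤u ⊕ 0≤u ⊗ p≤q⇒0≤q-p 1≤g))
    where
    lemma : ∀ k g u → (u ℚ.- (1ℚ ℚ.- k)) ℚ.+ u ℚ.* (g ℚ.- 1ℚ) ≡ (k ℚ.+ u ℚ.* g) ℚ.- 1ℚ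
    lemma = solve 3 (λ k g u → (u :- (con 1ℚ :- k)) :+ u :* (g :- con 1ℚ) := (k :+ u :* g) :- con 1ℚ) refl
  coeff-small : ∀ k {l} → ∣ k ∣ ≡ l → l ℚ.≤ s → 1ℚ ℚ.- k ℚ.≤ u
  coeff-small k refl l≤s = ℚ.+-monoʳ-≤ 1ℚ
    (ℚ.≤-trans (p≤∣p∣ (ℚ.- k)) (ℚ.≤-trans (ℚ.≤-reflexive (ℚ.∣-p∣≡∣p∣ k)) l≤s))
  1≤u : 1ℚ ℚ.- 1ℚ ℚ.≤ u
  1≤u = 0≤u
  a≤ : ∣ a ∣ ℚ.≤ s
  a≤ = ℚ.≤-trans (p≤p+q (ℚ.0≤∣p∣ b)) (p≤p+q (ℚ.0≤∣p∣ c))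
  b≤ : ∣ b ∣ ℚ.≤ s
  b≤ = ℚ.≤-trans (q≤p+q (ℚ.0≤∣p∣ a)) (p≤p+q (ℚ.0≤∣p∣ c))
  c≤ : ∣ c ∣ ℚ.≤ s
  c≤ = q≤p+q (ℚ.0≤∣p∣ a ⊕ ℚ.0≤∣p∣ b)

-[1+s]+s≡-1 : ∀ s → ℚ.- (1ℚ ℚ.+ s) ℚ.+ s ≡ ℚ.- 1ℚ
-[1+s]+s≡-1 = solve 1 (λ s → :- (con 1ℚ :+ s) :+ s := con (ℚ.- 1ℚ)) refl

sextic-bracket : ∀ a b c → sextic[-1] a b c ℚ.< 0ℚ → Bracket (sextic a b c)
sextic-bracket a b c neg = bracket (ℚ.- (1ℚ ℚ.+ s)) s
  (ℚ.0≤∣p∣ a ⊕ ℚ.0≤∣p∣ b ⊕ ℚ.0≤∣p∣ c)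
  (sextic[-u]≥0 a b c)
  (subst (ℚ._< 0ℚ) (sym (trans (cong ⟦ sextic a b c ⟧ (-[1+s]+s≡-1 s)) (sextic[-1]-correct a b c))) neg)
  where
  s : ℚ
  s = ∣ a ∣ ℚ.+ ∣ b ∣ ℚ.+ ∣ c ∣

hi-sextic-bracket : ∀ a b c neg → Bracket.hi (sextic-bracket a b c neg) ≡ ℚ.- 1ℚ
hi-sextic-bracket a b c neg = -[1+s]+s≡-1 (∣ a ∣ ℚ.+ ∣ b ∣ ℚ.+ ∣ c ∣)

-- The sign of P(-1)

salem⇒P[-1]≮0 : ∀ β {a b c} → IsSalem β → IsMinimalPolynomial β (sextic a b c) →
  ¬ (sextic[-1] a b c ℚ.< 0ℚ)
salem⇒P[-1]≮0 β {a} {b} {c} salem minimal neg =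
  let δ , 0<δ , away = lo-away-from-hi B
      -- The margin δ below -1 doubles as the precision: approximations s ≤ -1 - δ of α have s² ≥ (1
      -- + δ)², which rules out s² < 1 + δ.
      N , small = IsSalem.othersInDisc salem α (sextic a b c , minimal , root-isComplexRoot B) α≉β δ 0<δ
      s≤ = subst (seq (root B) N ℚ.+ δ ℚ.≤_) (hi-sextic-bracket a b c neg) (away N)
  in ℚ.<-irrefl refl (ℚ.<-≤-trans (small N ℕ.≤-refl) (outside (seq (root B) N) δ (ℚ.<⇒≤ 0<δ) s≤))
  where
  B : Bracket (sextic a b c)
  B = sextic-bracket a b c neg
  α : ℂ
  α = root B +i 0ℝ
  outside : ∀ s δ → 0ℚ ℚ.≤ δ → s ℚ.+ δ ℚ.≤ ℚ.- 1ℚ → 1ℚ ℚ.+ δ ℚ.≤ s ℚ.* s ℚ.+ 0ℚ ℚ.* 0ℚ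
  outside s δ 0≤δ s+δ≤-1 = 0≤q-p⇒p≤q (subst (0ℚ ℚ.≤_) (lemma s δ)
    (0≤δ ⊕ (0≤z ⊕ 0≤z) ⊕ (0≤z ⊕ 0≤δ) ⊗ (0≤z ⊕ 0≤δ)))
    where
    0≤z : 0ℚ ℚ.≤ ℚ.- 1ℚ ℚ.- (s ℚ.+ δ)
    0≤z = p≤q⇒0≤q-p s+δ≤-1
    lemma : ∀ s δ → let z = ℚ.- 1ℚ ℚ.- (s ℚ.+ δ) in
      δ ℚ.+ (z ℚ.+ z) ℚ.+ (z ℚ.+ δ) ℚ.* (z ℚ.+ δ) ≡ (s ℚ.* s ℚ.+ 0ℚ ℚ.* 0ℚ) ℚ.- (1ℚ ℚ.+ δ)
    lemma = solve 2 (λ s δ → let z = con (ℚ.- 1ℚ) :- (s :+ δ) in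
      δ :+ (z :+ z) :+ (z :+ δ) :* (z :+ δ) := (s :* s :+ con 0ℚ :* con 0ℚ) :- (con 1ℚ :+ δ)) refl
  separated : ∀ s x ε → 0ℚ ℚ.< ε → s ℚ.≤ ℚ.- 1ℚ → 1ℚ ℚ.+ ε ℚ.< x → 1ℚ ℚ.≤ ∣ s ℚ.- x ∣
  separated s x ε 0<ε s≤-1 1+ε<x =
    ℚ.≤-trans (0≤q-p⇒p≤q (subst (0ℚ ℚ.≤_) (lemma s x ε)
      (p≤q⇒0≤q-p s≤-1 ⊕ p≤q⇒0≤q-p (ℚ.<⇒≤ 1+ε<x) ⊕ ℚ.<⇒≤ 0<ε ⊕ ℚ.nonNegative⁻¹ 1ℚ)))
      (ℚ.≤-trans (p≤∣p∣ (ℚ.- (s ℚ.- x))) (ℚ.≤-reflexive (ℚ.∣-p∣≡∣p∣ (s ℚ.- x))))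
    where
    lemma : ∀ s x ε → (ℚ.- 1ℚ ℚ.- s) ℚ.+ (x ℚ.- (1ℚ ℚ.+ ε)) ℚ.+ ε ℚ.+ 1ℚ ≡ ℚ.- (s ℚ.- x) ℚ.- 1ℚ
    lemma = solve 3 (λ s x ε → (con (ℚ.- 1ℚ) :- s) :+ (x :- (con 1ℚ :+ ε)) :+ ε :+ con 1ℚ
      := :- (s :- x) :- con 1ℚ) refl
  α≉β : ¬ (α ≈ᶜ fromℝ β)
  α≉β (α≈β , _) =
    -- α ≤ -1 and β > 1 are more than 2 apart, so precision 1 already separates them.
    let M , close = α≈β 1ℚ (ℚ.positive⁻¹ 1ℚ)
        ε , 0<ε , N , 1+ε<β = IsSalem.greaterThanOne salem
        n = M ⊔ N
        s≤-1 = subst (seq (root B) n ℚ.≤_) (hi-sextic-bracket a b c neg) (proj₂ (lo-within B (z≤n {n})))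
    in ℚ.<-irrefl refl (ℚ.<-≤-trans (close n (ℕ.m≤m⊔n M N))
         (separated _ _ ε 0<ε s≤-1 (1+ε<β n (ℕ.m≤n⊔m M N))))

-- With β < 2 - a, evaluating at rational approximations x of β would give
-- x - 1 ≤ -P(x), although P(x) tends to 0 and x - 1 does not.
β≤2-a⇒P[-1]≱0 : ∀ β {a b c} → 1ℝ < β → evalℝ (sextic a b c) β ≈ 0ℝ →
  b ℚ.≤ 2ℚ ℚ.* a ℚ.- 3ℚ →
  ∃[ N ] (∀ n → N ℕ.≤ n → seq β n ℚ.≤ 2ℚ ℚ.- a) →
  ¬ (0ℚ ℚ.≤ sextic[-1] a b c)
β≤2-a⇒P[-1]≱0 β {a} {b} {c} (ε , 0<ε , K , 1+ε<β) Pβ≈0 b≤ (M , β≤) 0≤P[-1] =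
  -- The gap ε that witnesses β > 1 is reused as the precision of P(β) ≈ 0.
  let N , close = Pβ≈0 ε 0<ε
      n = K ⊔ M ⊔ N
      K≤n = ℕ.≤-trans (ℕ.m≤m⊔n K M) (ℕ.m≤m⊔n (K ⊔ M) N)
      M≤n = ℕ.≤-trans (ℕ.m≤n⊔m K M) (ℕ.m≤m⊔n (K ⊔ M) N)
      N≤n = ℕ.m≤n⊔m (K ⊔ M) N
  in contradiction (seq β n) (1+ε<β n K≤n) (β≤ n M≤n)
       (subst (λ y → ∣ y ℚ.- 0ℚ ∣ ℚ.< ε) (evalℝ-seq (sextic a b c) β n) (close n N≤n))
  where
  contradiction : ∀ x → 1ℚ ℚ.+ ε ℚ.< x → x ℚ.≤ 2ℚ ℚ.- a → ∣ ⟦ sextic a b c ⟧ x ℚ.- 0ℚ ∣ ℚ.< ε → ⊥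
  contradiction x 1+ε<x x≤ close = ℚ.<-irrefl refl (begin-strict
    ε                              <⟨ ε<x-1 ⟩
    x ℚ.- 1ℚ                       ≤⟨ x-1≤-sextic a b c x (ℚ.≤-trans (ℚ.<⇒≤ 0<ε) (ℚ.<⇒≤ ε<x-1))
                                        (p≤q⇒0≤q-p b≤) (p≤q⇒0≤q-p x≤) 0≤P[-1] ⟩
    ℚ.- y                          ≤⟨ p≤∣p∣ (ℚ.- y) ⟩
    ∣ ℚ.- y ∣                      ≡⟨ ℚ.∣-p∣≡∣p∣ y ⟩
    ∣ y ∣                          ≡⟨ cong ∣_∣ (ℚ.+-identityʳ y) ⟨
    ∣ y ℚ.- 0ℚ ∣                   <⟨ close ⟩
    ε                              ∎)
    where
    open ℚ.≤-Reasoning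
    y : ℚ
    y = ⟦ sextic a b c ⟧ x
    cancel : ∀ ε → 1ℚ ℚ.+ ε ℚ.- 1ℚ ≡ ε
    cancel = solve 1 (λ ε → con 1ℚ :+ ε :- con 1ℚ := ε) refl
    ε<x-1 : ε ℚ.< x ℚ.- 1ℚ
    ε<x-1 = subst (ℚ._< x ℚ.- 1ℚ) (cancel ε) (ℚ.+-monoˡ-< (ℚ.- 1ℚ) 1+ε<x)

-- Since r₀ = 1, the first floor condition reads β < c₁ + 1 ≤ 2 - a. It is passed on as a bound on
-- rational approximations, at which the identity for P is evaluated.
first-digit⇒upper-bound : ∀ β a c → IsGreedyExpansion β c → c 1 ≤ 1ℤ - a →
  ∃[ N ] (∀ n → N ℕ.≤ n → seq β n ℚ.≤ 2ℚ ℚ.- ℤ→ℚ a)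
first-digit⇒upper-bound β a c greedy c₁≤1-a =
  let ε , 0<ε , N , β<c₁+1 = proj₂ (greedy 0)
  in N , λ n N≤n → bound (seq β n) ε 0<ε (β<c₁+1 n N≤n)
  where
  open ℚ.≤-Reasoning
  bound : ∀ x ε → 0ℚ ℚ.< ε → x ℚ.* 1ℚ ℚ.+ ε ℚ.< ℤ→ℚ (c 1) ℚ.+ 1ℚ → x ℚ.≤ 2ℚ ℚ.- ℤ→ℚ a
  bound x ε 0<ε x<c₁+1 = begin
    x                              ≡⟨ lemma₁ x ⟨
    x ℚ.* 1ℚ ℚ.+ 0ℚ                ≤⟨ ℚ.+-monoʳ-≤ (x ℚ.* 1ℚ) (ℚ.<⇒≤ 0<ε) ⟩
    x ℚ.* 1ℚ ℚ.+ ε                 <⟨ x<c₁+1 ⟩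
    ℤ→ℚ (c 1) ℚ.+ 1ℚ               ≤⟨ ℚ.+-monoˡ-≤ 1ℚ (ℤ→ℚ-mono-≤ c₁≤1-a) ⟩
    ℤ→ℚ (1ℤ - a) ℚ.+ 1ℚ            ≡⟨ cong (ℚ._+ 1ℚ) (ℤ→ℚ-- 1ℤ a) ⟩
    1ℚ ℚ.- ℤ→ℚ a ℚ.+ 1ℚ            ≡⟨ lemma₂ (ℤ→ℚ a) ⟩
    2ℚ ℚ.- ℤ→ℚ a                   ∎
    where
    lemma₁ : ∀ x → x ℚ.* 1ℚ ℚ.+ 0ℚ ≡ x
    lemma₁ = solve 1 (λ x → x :* con 1ℚ :+ con 0ℚ := x) refl
    lemma₂ : ∀ a → 1ℚ ℚ.- a ℚ.+ 1ℚ ≡ 2ℚ ℚ.- a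
    lemma₂ = solve 1 (λ a → con 1ℚ :- a :+ con 1ℚ := con 2ℚ :- a) refl

proposition4p1 : (β : ℝ) (a b c : ℤ) →
    let P : ℤ[x].Poly
        P = + 1 ∷ a ∷ b ∷ c ∷ b ∷ a ∷ + 1 ∷ []
    in IsSalem β →
       IsMinimalPolynomial β (ℤ[x]→ℚ[x] P) →
       b ≤ + 2 * a - + 3 →
       ¬ (∃[ n ] ∃[ Q ] (1 ℕ.≤ n × IsCyclotomic n Q × IsCofactor β P Q))
proposition4p1 β a b c salem minimal b≤2a-3 (n , Q , 1≤n , Φ , cofactor) =
  β≤2-a⇒P[-1]≱0 β {ℤ→ℚ a} {c = ℤ→ℚ c} (IsSalem.greaterThanOne salem) (IsMinimalPolynomial.root minimal) b≤
    (first-digit⇒upper-bound β a digits greedy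
      (first-digit-bound {Q = Q} digits preperiod period 1≤n Φ P-Top
        (HasPreperiodAndPeriod.period≥1 periodic) factorization))
    (ℚ.≮⇒≥ (salem⇒P[-1]≮0 β salem minimal))
  where
  open IsCofactor cofactor hiding (minimal)
  P-Top : Top 6 1ℤ a (+ 1 ∷ a ∷ b ∷ c ∷ b ∷ a ∷ + 1 ∷ [])
  P-Top = mkTop refl refl (coeff-beyond (+ 1 ∷ a ∷ b ∷ c ∷ b ∷ a ∷ + 1 ∷ []))
  b≤ : ℤ→ℚ b ℚ.≤ 2ℚ ℚ.* ℤ→ℚ a ℚ.- 3ℚ
  b≤ = subst (ℤ→ℚ b ℚ.≤_)
    (trans (ℤ→ℚ-- (+ 2 * a) (+ 3)) (cong (ℚ._- 3ℚ) (ℤ→ℚ-* (+ 2) a)))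
    (ℤ→ℚ-mono-≤ b≤2a-3)
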